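{- For every $n\ge2$, the number of rectangular ascending polyominoes of semi-perimeter $n$ is $\binom{2n-4}{n-2}$; equivalently their generating function by semi-perimeter is $\dfrac{t^2}{\sqrt{1-4t}}$.
   Context: A polyomino is a finite edge-connected set of unit cells; it is convex if every row and column is a contiguous segment; its semi-perimeter is the width plus the height of its minimal bounding rectangle. A NW-path inside $P$ is a sequence of cells of $P$, consecutive cells sharing an edge, each step North or West; write $a\nwarrow b$ if such a path exists, let $D_{NW}(a,b)$ be the minimum number of direction changes over such paths, and $D_{NW}(P)=\max\{D_{NW}(a,b):a\nwarrow b\}$. A convex polyomino is ascending if $D_{NW}(P)\le1$. An ascending polyomino $P$ is rectangular if the topmost cell of its rightmost column attains the maximum height among all cells of $P$. -}

module Defs where

open import Data.Nat using (ℕ; zero; suc; _+_; _∸_; _≤_; _<_; _*_)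
open import Data.Nat.Combinatorics using (_C_)
open import Data.Bool using (Bool; true; false)
open import Data.Vec using (Vec; []; _∷_)
open import Data.List using (List; []; _∷_; length)
open import Data.List.Membership.Propositional using (_∈_)
open import Data.List.Relation.Unary.Unique.Propositional using (Unique)
open import Data.Product using (Σ; ∃; _×_; _,_)
open import Relation.Binary.PropositionalEquality using (_≡_)
open import Function.Bundles using (_⇔_)

-- A polyomino (up to translation) is represented by its minimal
-- bounding rectangle of width w and height h together with the
-- w × h grid of cells: column x (0 ≤ x < w, increasing to the East),
-- row y (0 ≤ y < h, increasing to the North).  Entry true = cell in P.

Shape : Set
Shape = Σ ℕ λ w → Σ ℕ λ h → Vec (Vec Bool h) w

atCol : ∀ {h} → Vec Bool h → ℕ → Bool
atCol []       _       = false
atCol (b ∷ _)  zero    = b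
atCol (_ ∷ bs) (suc y) = atCol bs y

atGrid : ∀ {w h} → Vec (Vec Bool h) w → ℕ → ℕ → Bool
atGrid []       _       _ = false
atGrid (c ∷ _)  zero    y = atCol c y
atGrid (_ ∷ cs) (suc x) y = atGrid cs x y

In : Shape → ℕ → ℕ → Set
In (w , h , g) x y = atGrid g x y ≡ true

width height : Shape → ℕ
width  (w , _ , _) = w
height (_ , h , _) = h

semiPerimeter : Shape → ℕ
semiPerimeter P = width P + height P

MinimalBox : Shape → Set
MinimalBox P =
  (∀ x → x < width P → ∃ λ y → In P x y) ×
  (∀ y → y < height P → ∃ λ x → In P x y)

data Adjacent : ℕ → ℕ → ℕ → ℕ → Set where
  east  : ∀ x y → Adjacent x y (suc x) y
  west  : ∀ x y → Adjacent (suc x) y x y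
  north : ∀ x y → Adjacent x y x (suc y)
  south : ∀ x y → Adjacent x (suc y) x y

data CellPath (P : Shape) : ℕ → ℕ → ℕ → ℕ → Set where
  here : ∀ {x y} → In P x y → CellPath P x y x y
  step : ∀ {x y x₁ y₁ x' y'} → In P x y → Adjacent x y x₁ y₁ →
         CellPath P x₁ y₁ x' y' → CellPath P x y x' y'

IsPolyomino : Shape → Set
IsPolyomino P =
  (∃ λ x → ∃ λ y → In P x y) ×
  (∀ x y x' y' → In P x y → In P x' y' → CellPath P x y x' y')

Convex : Shape → Set
Convex P =
  (∀ x₁ x x₂ y → In P x₁ y → In P x₂ y → x₁ ≤ x → x ≤ x₂ → In P x y) ×
  (∀ x y₁ y y₂ → In P x y₁ → In P x y₂ → y₁ ≤ y → y ≤ y₂ → In P x y)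

data Dir : Set where
  N W : Dir

data NWPath (P : Shape) : ℕ → ℕ → List Dir → ℕ → ℕ → Set where
  done  : ∀ {x y} → In P x y → NWPath P x y [] x y
  stepN : ∀ {x y s x' y'} → In P x y → NWPath P x (suc y) s x' y' →
          NWPath P x y (N ∷ s) x' y'
  stepW : ∀ {x y s x' y'} → In P (suc x) y → NWPath P x y s x' y' →
          NWPath P (suc x) y (W ∷ s) x' y'

sameDir : Dir → Dir → Bool
sameDir N N = true
sameDir W W = true
sameDir _ _ = false

changesFrom : Dir → List Dir → ℕ
changesFrom d []      = 0
changesFrom d (e ∷ s) with sameDir d e
... | true  = changesFrom e s
... | false = suc (changesFrom e s)

changes : List Dir → ℕ
changes []      = 0
changes (d ∷ s) = changesFrom d s

-- D_NW(P) ≤ 1 : for all a, b with a ↖ b, D_NW(a,b) ≤ 1, i.e. some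
-- NW-path from a to b has at most one direction change
DNW≤1 : Shape → Set
DNW≤1 P = ∀ x y x' y' s → NWPath P x y s x' y' →
          ∃ λ s' → NWPath P x y s' x' y' × changes s' ≤ 1

Ascending : Shape → Set
Ascending P = IsPolyomino P × Convex P × DNW≤1 P

Rectangular : Shape → Set
Rectangular P = ∃ λ x → ∃ λ y →
  In P x y ×
  (∀ x' y' → In P x' y' → x' ≤ x) ×
  (∀ y' → In P x y' → y' ≤ y) ×
  (∀ x' y' → In P x' y' → y' ≤ y)

RectAscOfSemiPerimeter : ℕ → Shape → Set
RectAscOfSemiPerimeter n P =
  MinimalBox P × Ascending P × Rectangular P × semiPerimeter P ≡ n

HasCount : (Shape → Set) → ℕ → Set
HasCount Q k = Σ (List Shape) λ L →
  Unique L × (∀ P → (P ∈ L) ⇔ Q P) × length L ≡ k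

{-# OPTIONS --safe #-}
-- The polyominoes in question are exactly the convex polyominoes containing the
-- NE corner of their bounding box: given the corner, column tops cannot decrease
-- eastwards, so a NW-path may always be replaced by one going north and then west.
--
-- Such a polyomino is grown leftwards from its last column.  Until row 0 is
-- reached, a column [b , t] is followed by [b′ , t′] with b′ ≤ b ≤ t′ ≤ t, and
-- afterwards by [b′ , t′] with b ≤ b′ ≤ t′ ≤ t.  In the second phase k more columns
-- can be added in C(2k + t − b, 2k) ways; in the first phase the number of ways is
-- the sum over i + j + 1 = k of
--   C(k + t, k + i) C(k + b − 1, j) − C(k + t, j) C(k + b − 1, k + i).
-- Summing over the last column makes this telescope to C(k + t, k)² for width k + 1
-- and height t + 1, and Vandermonde's identity adds these up to C(2n − 4, n − 2).
module Submission where

open import Defs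
open import Algebra.Properties.CommutativeSemigroup using (interchange)
open import Data.Bool using (Bool; true; false; _∧_; T)
open import Data.Bool.Properties using (T-≡; T-∧)
open import Data.Empty using (⊥-elim)
open import Data.Fin using (toℕ)
open import Data.Integer using (ℤ; 0ℤ; 1ℤ; +_) renaming (_+_ to _⊕_; _*_ to _⊛_; _-_ to _⊖_)
import Data.Integer.Properties as ℤ
open import Data.Integer.Tactic.RingSolver using (solve-∀)
open import Data.List using (List; []; _∷_; _++_; replicate; length)
open import Data.List.Membership.Propositional using (_∈_)
open import Data.List.Membership.Propositional.Properties using (∈-++⁺ˡ; ∈-++⁺ʳ; ∈-++⁻)
open import Data.List.Properties using (length-++)
open import Data.List.Relation.Unary.All using ([])
open import Data.List.Relation.Unary.AllPairs using ([]; _∷_)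
open import Data.List.Relation.Unary.Any using (here)
open import Data.List.Relation.Unary.Unique.Propositional using (Unique)
open import Data.List.Relation.Unary.Unique.Propositional.Properties using (++⁺)
open import Data.Nat using (ℕ; zero; suc; _+_; _*_; _∸_; _≤_; _<_; _≥_; _≤ᵇ_; z≤n; s≤s; _≤?_)
open import Data.Nat.Combinatorics using (_C_; nCk+nC[k+1]≡[n+1]C[k+1]; k>n⇒nCk≡0; nCk≡nC[n∸k]; nCn≡1)
open import Data.Nat.Properties
open import Data.Product using (∃; ∃₂; _×_; _,_; proj₁; proj₂)
open import Data.Sum using (_⊎_; inj₁; inj₂; map)
open import Data.Vec using (Vec; []; _∷_; tabulate)
open import Function using (_∘_; flip; case_of_)
open import Function.Bundles using (Equivalence; mk⇔)
open import Relation.Binary.Definitions using (Reflexive; Antisymmetric; Total)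
open import Relation.Binary.PropositionalEquality
open import Relation.Nullary using (yes; no)

-- Sums of binomial coefficients

Σ[<_] : ℕ → (ℕ → ℤ) → ℤ
Σ[< zero ]  f = 0ℤ
Σ[< suc n ] f = Σ[< n ] f ⊕ f n

-- The sum of f i j over i + j + 1 = n.
conv : ℕ → (ℕ → ℕ → ℤ) → ℤ
conv zero    f = 0ℤ
conv (suc n) f = f n 0 ⊕ conv n (λ i j → f i (suc j))

Σ-cong : ∀ n {f g : ℕ → ℤ} → (∀ i → i < n → f i ≡ g i) → Σ[< n ] f ≡ Σ[< n ] g
Σ-cong zero    e = refl
Σ-cong (suc n) e = cong₂ _⊕_ (Σ-cong n (λ i i<n → e i (m<n⇒m<1+n i<n))) (e n ≤-refl)

Σ-⊕ : ∀ n (f g : ℕ → ℤ) → Σ[< n ] (λ i → f i ⊕ g i) ≡ Σ[< n ] f ⊕ Σ[< n ] g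
Σ-⊕ zero f g = refl
Σ-⊕ (suc n) f g rewrite Σ-⊕ n f g = interchange ℤ.+-commutativeSemigroup (Σ[< n ] f) (Σ[< n ] g) (f n) (g n)

Σ-linear : ∀ n (f g : ℕ → ℤ) x y →
  Σ[< n ] (λ i → f i ⊛ x ⊖ g i ⊛ y) ≡ Σ[< n ] f ⊛ x ⊖ Σ[< n ] g ⊛ y
Σ-linear zero f g x y = lem x y
  where
  lem : ∀ x y → 0ℤ ≡ 0ℤ ⊛ x ⊖ 0ℤ ⊛ y
  lem = solve-∀
Σ-linear (suc n) f g x y rewrite Σ-linear n f g x y = lem (Σ[< n ] f) (Σ[< n ] g) (f n) (g n) x y
  where
  lem : ∀ a b c d x y → (a ⊛ x ⊖ b ⊛ y) ⊕ (c ⊛ x ⊖ d ⊛ y) ≡ (a ⊕ c) ⊛ x ⊖ (b ⊕ d) ⊛ y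
  lem = solve-∀

conv-cong : ∀ n {f g : ℕ → ℕ → ℤ} → (∀ i j → f i j ≡ g i j) → conv n f ≡ conv n g
conv-cong zero    e = refl
conv-cong (suc n) e = cong₂ _⊕_ (e n 0) (conv-cong n (λ i j → e i (suc j)))

conv-⊕ : ∀ n (f g : ℕ → ℕ → ℤ) → conv n (λ i j → f i j ⊕ g i j) ≡ conv n f ⊕ conv n g
conv-⊕ zero f g = refl
conv-⊕ (suc n) f g rewrite conv-⊕ n (λ i j → f i (suc j)) (λ i j → g i (suc j)) =
  interchange ℤ.+-commutativeSemigroup (f n 0) (g n 0) _ _

conv-⊖ : ∀ n (f g : ℕ → ℕ → ℤ) → conv n (λ i j → f i j ⊖ g i j) ≡ conv n f ⊖ conv n g
conv-⊖ zero f g = refl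
conv-⊖ (suc n) f g
  rewrite conv-⊖ n (λ i j → f i (suc j)) (λ i j → g i (suc j)) =
  lem (f n 0) (g n 0) (conv n (λ i j → f i (suc j))) (conv n (λ i j → g i (suc j)))
  where
  lem : ∀ a b c d → (a ⊖ b) ⊕ (c ⊖ d) ≡ (a ⊕ c) ⊖ (b ⊕ d)
  lem = solve-∀

conv-last : ∀ n (f : ℕ → ℕ → ℤ) → conv (suc n) f ≡ conv n (λ i j → f (suc i) j) ⊕ f 0 n
conv-last zero    f = ℤ.+-comm (f 0 0) 0ℤ
conv-last (suc n) f rewrite conv-last n (λ i j → f i (suc j)) =
  sym (ℤ.+-assoc (f (suc n) 0) _ (f 0 (suc n)))

-- Consecutive terms lie next to each other on the antidiagonal i + j = n and cancel; only its two
-- ends survive.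
conv-telescope : ∀ n (u : ℕ → ℕ → ℤ) →
  conv n (λ i j → u i (suc j) ⊖ u (suc i) j) ≡ u 0 n ⊖ u n 0
conv-telescope zero    u = sym (ℤ.+-inverseʳ (u 0 0))
conv-telescope (suc n) u rewrite conv-telescope n (λ i j → u i (suc j)) =
  lem (u n 1) (u (suc n) 0) (u 0 (suc n))
  where
  lem : ∀ a b c → (a ⊖ b) ⊕ (c ⊖ a) ≡ c ⊖ b
  lem = solve-∀

Σ-conv : ∀ n k (f : ℕ → ℕ → ℕ → ℤ) →
  Σ[< n ] (λ l → conv k (f l)) ≡ conv k (λ i j → Σ[< n ] (λ l → f l i j))
Σ-conv n zero f = zeros n
  where
  zeros : ∀ n → Σ[< n ] (λ _ → 0ℤ) ≡ 0ℤ
  zeros zero    = refl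
  zeros (suc n) = cong (_⊕ 0ℤ) (zeros n)
Σ-conv n (suc k) f =
  trans (Σ-⊕ n _ _) (cong (Σ[< n ] (λ l → f l k 0) ⊕_) (Σ-conv n k (λ l i j → f l i (suc j))))

-- The arguments of `f` are swapped because `conv` peels off j = 0 first, which has to match the
-- first term of the left-hand sum, exposed by `head`.
Σ-as-conv : ∀ n (f : ℕ → ℕ → ℤ) → Σ[< suc n ] (λ k → f k (n ∸ k)) ≡ conv (suc n) (λ i j → f j i)
Σ-as-conv n f = go n f
  where
  head : ∀ n (g : ℕ → ℤ) → Σ[< suc n ] g ≡ g 0 ⊕ Σ[< n ] (λ i → g (suc i))
  head zero    g = ℤ.+-comm 0ℤ (g 0)
  head (suc n) g rewrite head n g = ℤ.+-assoc (g 0) _ (g (suc n))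
  go : ∀ n f → Σ[< suc n ] (λ k → f k (n ∸ k)) ≡ conv (suc n) (λ i j → f j i)
  go zero    f = ℤ.+-comm 0ℤ (f 0 0)
  go (suc n) f = trans (head (suc n) (λ k → f k (suc n ∸ k)))
                       (cong (f 0 (suc n) ⊕_) (go n (λ k → f (suc k))))

binom : ℕ → ℕ → ℤ
binom n k = + (n C k)

pascal : ∀ n k → binom (suc n) (suc k) ≡ binom n k ⊕ binom n (suc k)
pascal n k = trans (cong +_ (sym (nCk+nC[k+1]≡[n+1]C[k+1] n k))) (ℤ.pos-+ (n C k) _)

binom-zero : ∀ n → binom n 0 ≡ 1ℤ
binom-zero n = cong +_ (trans (nCk≡nC[n∸k] {0} {n} z≤n) (nCn≡1 n))

binom-> : ∀ {n k} → n < k → binom n k ≡ 0ℤ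
binom-> n<k = cong +_ (k>n⇒nCk≡0 n<k)

hockey-stick : ∀ m a n → Σ[< n ] (λ i → binom (m + i) a) ≡ binom (m + n) (suc a) ⊖ binom m (suc a)
hockey-stick m a zero rewrite +-identityʳ m = sym (ℤ.+-inverseʳ (binom m (suc a)))
hockey-stick m a (suc n) rewrite hockey-stick m a n | +-suc m n | pascal (m + n) a =
  lem (binom (m + n) (suc a)) (binom m (suc a)) (binom (m + n) a)
  where
  lem : ∀ x y z → (x ⊖ y) ⊕ z ≡ (z ⊕ x) ⊖ y
  lem = solve-∀

-- Induction on `k` with `n` and `r` free: Pascal's rule splits the factor from row k + 1, and the
-- two resulting sums recombine by Pascal's rule in the other factor, giving the case of `suc n` and
-- `suc r`.
vandermonde : ∀ k n r →
  conv (suc k) (λ i j → binom k j ⊛ binom n (r + i)) ≡ binom (k + n) (k + r)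
vandermonde zero n r rewrite +-identityʳ r = lem (binom n r)
  where
  lem : ∀ a → 1ℤ ⊛ a ⊕ 0ℤ ≡ a
  lem = solve-∀
vandermonde (suc k) n r = begin
  binom (suc k) 0 ⊛ binom n (r + suc k) ⊕ conv (suc k) (λ i j → binom (suc k) (suc j) ⊛ binom n (r + i))
    ≡⟨ cong₂ _⊕_ (cong (_⊛ binom n (r + suc k)) (trans (binom-zero (suc k)) (sym (binom-zero k))))
                 (trans (conv-cong (suc k) λ i j →
                          trans (cong (_⊛ binom n (r + i)) (pascal k j)) (distr (binom k j) (binom k (suc j)) (binom n (r + i))))
                        (conv-⊕ (suc k) G (λ i j → G i (suc j)))) ⟩
  G (suc k) 0 ⊕ (conv (suc k) G ⊕ conv (suc k) (λ i j → G i (suc j)))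
    ≡⟨ swap (G (suc k) 0) (conv (suc k) G) (conv (suc k) (λ i j → G i (suc j))) ⟩
  conv (suc k) G ⊕ conv (suc (suc k)) G
    ≡⟨ cong (conv (suc k) G ⊕_) (conv-last (suc k) G) ⟩
  conv (suc k) G ⊕ (conv (suc k) (λ i j → G (suc i) j) ⊕ G 0 (suc k))
    -- The term split off at the end carries C(k, k + 1) = 0.
    ≡⟨ cong (λ z → conv (suc k) G ⊕ (conv (suc k) (λ i j → G (suc i) j) ⊕ z ⊛ binom n (r + 0)))
            (binom-> {k} ≤-refl) ⟩
  conv (suc k) G ⊕ (conv (suc k) (λ i j → G (suc i) j) ⊕ 0ℤ)
    ≡⟨ cong (conv (suc k) G ⊕_) (ℤ.+-identityʳ _) ⟩
  conv (suc k) G ⊕ conv (suc k) (λ i j → G (suc i) j)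
    ≡⟨ conv-⊕ (suc k) G (λ i j → G (suc i) j) ⟨
  conv (suc k) (λ i j → G i j ⊕ G (suc i) j)
    ≡⟨ conv-cong (suc k) (λ i j →
         trans (sym (ℤ.*-distribˡ-+ (binom k j) (binom n (r + i)) (binom n (r + suc i))))
               (cong (binom k j ⊛_)
                  (trans (cong (λ z → binom n (r + i) ⊕ binom n z) (+-suc r i))
                         (sym (pascal n (r + i)))))) ⟩
  conv (suc k) (λ i j → binom k j ⊛ binom (suc n) (suc r + i))
    ≡⟨ vandermonde k (suc n) (suc r) ⟩
  binom (k + suc n) (k + suc r)
    ≡⟨ cong₂ binom (+-suc k n) (+-suc k r) ⟩
  binom (suc k + n) (suc k + r) ∎
  where
  open ≡-Reasoning
  G : ℕ → ℕ → ℤ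
  G i j = binom k j ⊛ binom n (r + i)
  distr : ∀ a b c → (a ⊕ b) ⊛ c ≡ a ⊛ c ⊕ b ⊛ c
  distr = solve-∀
  swap : ∀ a b c → a ⊕ (b ⊕ c) ≡ b ⊕ (a ⊕ c)
  swap = solve-∀

-- Counting completions in the two phases

det : (p q a c : ℕ) → ℤ
det p q a c = binom p a ⊛ binom q c ⊖ binom p c ⊛ binom q a

-- A sum of 2 × 2 minors of Pascal's triangle, all taken from the rows `k + t` and `k + β`.
openCount : (k β t : ℕ) → ℤ
openCount k β t = conv k (λ i j → det (k + t) (k + β) (k + i) j)

-- The factors C(k, j + 1) kept inside the sum are those that `Σ-openCount` leaves over with the
-- opposite sign, so that the two can cancel.
vandermonde′ : ∀ k n r →
  binom n (r + k) ⊕ conv k (λ i j → binom k (suc j) ⊛ binom n (r + i)) ≡ binom (k + n) (k + r)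
vandermonde′ k n r = trans
  (cong (_⊕ conv k (λ i j → binom k (suc j) ⊛ binom n (r + i)))
        (sym (trans (cong (_⊛ binom n (r + k)) (binom-zero k)) (ℤ.*-identityˡ _))))
  (vandermonde k n r)

binom-above : ∀ k i → binom k (suc (k + i)) ≡ 0ℤ
binom-above k i = binom-> (s≤s (m≤m+n k i))

-- Here d = t - b belongs to the present column, while d′ = t′ - b and i = t′ - b′ describe the next
-- one. The hockey-stick identity is applied once per sum; its lower boundary terms vanish because
-- their lower index exceeds the upper one.
closed-step : ∀ k d →
  Σ[< suc d ] (λ d′ → Σ[< suc d′ ] (λ i → binom (k + k + i) (k + k)))
    ≡ binom (suc k + suc k + d) (suc k + suc k)
closed-step k d = begin
  Σ[< suc d ] (λ d′ → Σ[< suc d′ ] (λ i → binom (k + k + i) (k + k)))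
    ≡⟨ Σ-cong (suc d) (λ d′ _ → trans (hockey-stick (k + k) (k + k) (suc d′))
         (trans (cong₂ (λ x y → binom x (suc (k + k)) ⊖ y) (+-suc (k + k) d′) (binom-> {k + k} ≤-refl))
                (ℤ.+-identityʳ _))) ⟩
  Σ[< suc d ] (λ d′ → binom (suc (k + k) + d′) (suc (k + k)))
    ≡⟨ hockey-stick (suc (k + k)) (suc (k + k)) (suc d) ⟩
  binom (suc (k + k) + suc d) (suc (suc (k + k))) ⊖ binom (suc (k + k)) (suc (suc (k + k)))
    ≡⟨ cong₂ (λ x y → binom x (suc (suc (k + k))) ⊖ y) (+-suc (suc (k + k)) d)
             (binom-> {suc (k + k)} ≤-refl) ⟩
  binom (suc (suc (k + k)) + d) (suc (suc (k + k))) ⊖ 0ℤ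
    ≡⟨ ℤ.+-identityʳ _ ⟩
  binom (suc (suc (k + k)) + d) (suc (suc (k + k)))
    ≡⟨ cong (λ z → binom (suc z + d) (suc z)) (+-suc k k) ⟨
  binom (suc k + suc k + d) (suc k + suc k) ∎
  where open ≡-Reasoning

-- Only the row `k + β` of each minor depends on β, so the hockey-stick identity acts on its
-- entries. The lower boundary term C(k, k + i + 1) vanishes, whereas C(k, j + 1) stays.
Σ-openCount : ∀ k n t → Σ[< n ] (λ β → openCount k β t) ≡
  conv k (λ i j → binom (k + t) (k + i) ⊛ (binom (k + n) (suc j) ⊖ binom k (suc j))
                  ⊖ binom (k + t) j ⊛ binom (k + n) (suc (k + i)))
Σ-openCount k n t = trans (Σ-conv n k _) (conv-cong k λ i j → begin
  Σ[< n ] (λ β → det (k + t) (k + β) (k + i) j)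
    ≡⟨ Σ-cong n (λ β _ → comm (binom (k + t) (k + i)) (binom (k + β) j) (binom (k + t) j) (binom (k + β) (k + i))) ⟩
  Σ[< n ] (λ β → binom (k + β) j ⊛ binom (k + t) (k + i) ⊖ binom (k + β) (k + i) ⊛ binom (k + t) j)
    ≡⟨ Σ-linear n (λ β → binom (k + β) j) (λ β → binom (k + β) (k + i)) _ _ ⟩
  Σ[< n ] (λ β → binom (k + β) j) ⊛ binom (k + t) (k + i)
    ⊖ Σ[< n ] (λ β → binom (k + β) (k + i)) ⊛ binom (k + t) j
    ≡⟨ cong₂ (λ x y → x ⊛ binom (k + t) (k + i) ⊖ y ⊛ binom (k + t) j)
         (hockey-stick k j n)
         (trans (hockey-stick k (k + i) n)
                (trans (cong (binom (k + n) (suc (k + i)) ⊖_) (binom-above k i)) (ℤ.+-identityʳ (binom (k + n) (suc (k + i)))))) ⟩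
  (binom (k + n) (suc j) ⊖ binom k (suc j)) ⊛ binom (k + t) (k + i)
    ⊖ binom (k + n) (suc (k + i)) ⊛ binom (k + t) j
    ≡⟨ comm (binom (k + n) (suc j) ⊖ binom k (suc j)) (binom (k + t) (k + i))
            (binom (k + n) (suc (k + i))) (binom (k + t) j) ⟩
  binom (k + t) (k + i) ⊛ (binom (k + n) (suc j) ⊖ binom k (suc j))
    ⊖ binom (k + t) j ⊛ binom (k + n) (suc (k + i)) ∎)
  where
  open ≡-Reasoning
  comm : ∀ a b c d → a ⊛ b ⊖ c ⊛ d ≡ b ⊛ a ⊖ d ⊛ c
  comm = solve-∀

-- The last column has top `t` and bottom 0 or β + 1 with β < t. Expanding the first count by
-- Vandermonde cancels the C(k, j + 1) terms of the second, and the rest telescopes along `u`.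
box-count : ∀ k t →
  binom (k + k + t) (k + k) ⊕ Σ[< t ] (λ β → openCount k β t) ≡ binom (k + t) k ⊛ binom (k + t) k
box-count k t = begin
  binom (k + k + t) (k + k) ⊕ Σ[< t ] (λ β → openCount k β t)
    ≡⟨ cong₂ _⊕_ (trans (cong (λ z → binom z (k + k)) (+-assoc k k t)) (sym (vandermonde′ k n k)))
                 (Σ-openCount k t t) ⟩
  (binom n (k + k) ⊕ conv k fringe) ⊕ conv k swept
    ≡⟨ trans (ℤ.+-assoc (binom n (k + k)) (conv k fringe) (conv k swept))
             (cong (binom n (k + k) ⊕_) (sym (conv-⊕ k fringe swept))) ⟩
  binom n (k + k) ⊕ conv k (λ i j → fringe i j ⊕ swept i j)
    ≡⟨ cong (binom n (k + k) ⊕_) (conv-cong k λ i j →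
         trans (lem₁ (binom k (suc j)) (binom n (k + i)) (binom n (suc j)) (binom n j) (binom n (suc (k + i))))
               (cong (λ z → u i (suc j) ⊖ binom n j ⊛ binom n z) (sym (+-suc k i)))) ⟩
  binom n (k + k) ⊕ conv k (λ i j → u i (suc j) ⊖ u (suc i) j)
    ≡⟨ cong (binom n (k + k) ⊕_) (conv-telescope k u) ⟩
  binom n (k + k) ⊕ (binom n k ⊛ binom n (k + 0) ⊖ binom n 0 ⊛ binom n (k + k))
    ≡⟨ cong₂ (λ x y → binom n (k + k) ⊕ (binom n k ⊛ binom n x ⊖ y ⊛ binom n (k + k)))
             (+-identityʳ k) (binom-zero n) ⟩
  binom n (k + k) ⊕ (binom n k ⊛ binom n k ⊖ 1ℤ ⊛ binom n (k + k))
    ≡⟨ lem₂ (binom n (k + k)) (binom n k) ⟩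
  binom n k ⊛ binom n k ∎
  where
  open ≡-Reasoning
  n : ℕ
  n = k + t
  u fringe swept : ℕ → ℕ → ℤ
  fringe i j = binom k (suc j) ⊛ binom n (k + i)
  swept i j = binom n (k + i) ⊛ (binom n (suc j) ⊖ binom k (suc j)) ⊖ binom n j ⊛ binom n (suc (k + i))
  u i j = binom n j ⊛ binom n (k + i)
  lem₁ : ∀ a b c d e → a ⊛ b ⊕ (b ⊛ (c ⊖ a) ⊖ d ⊛ e) ≡ c ⊛ b ⊖ d ⊛ e
  lem₁ = solve-∀
  lem₂ : ∀ a b → a ⊕ (b ⊛ b ⊖ 1ℤ ⊛ a) ≡ b ⊛ b
  lem₂ = solve-∀

-- The column after [β + 1 , t] has top t′ = β + 1 + d′ and a bottom that is either 0, which closes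
-- the grid, or β′ + 1 with β′ ≤ β. Summing over t′ gives differences of the rows `p` and `q`; the
-- C(k, j + 1) terms cancel as in `box-count`, and subtracting row `q` from row `p` does not change
-- a determinant.
open-step : ∀ k β d →
  Σ[< suc d ] (λ d′ → binom (k + k + (suc β + d′)) (k + k)
                      ⊕ Σ[< suc β ] (λ β′ → openCount k β′ (suc β + d′)))
    ≡ openCount (suc k) β (suc β + d)
open-step k β d = begin
  Σ[< suc d ] (λ d′ → binom (k + k + (b + d′)) (k + k) ⊕ Σ[< b ] (λ β′ → openCount k β′ (b + d′)))
    ≡⟨ Σ-⊕ (suc d) _ _ ⟩
  Σ[< suc d ] (λ d′ → binom (k + k + (b + d′)) (k + k))
    ⊕ Σ[< suc d ] (λ d′ → Σ[< b ] (λ β′ → openCount k β′ (b + d′)))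
    ≡⟨ cong₂ _⊕_ source sweep ⟩
  ((binom p (suc k + k) ⊕ conv k (fringe p))
    ⊖ (binom q (suc k + k) ⊕ conv k (fringe q)))
    ⊕ conv k swept
    ≡⟨ regroup (binom p (suc k + k)) (conv k (fringe p)) (binom q (suc k + k)) (conv k (fringe q)) (conv k swept) ⟩
  (binom p (suc k + k) ⊖ binom q (suc k + k))
    ⊕ ((conv k (fringe p)
        ⊖ conv k (fringe q)) ⊕ conv k swept)
    ≡⟨ cong₂ _⊕_ corner (trans (cong (_⊕ conv k swept) (sym (conv-⊖ k (fringe p) (fringe q))))
                             (sym (conv-⊕ k (λ i j → fringe p i j ⊖ fringe q i j) swept))) ⟩
  det p q (suc k + k) 0
    ⊕ conv k (λ i j → (fringe p i j ⊖ fringe q i j) ⊕ swept i j)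
    ≡⟨ cong (det p q (suc k + k) 0 ⊕_) (conv-cong k λ i j →
         collect (binom k (suc j)) (binom p (suc k + i)) (binom q (suc k + i))
                 (binom p (suc j)) (binom q (suc j))) ⟩
  -- `corner` is the term i = k, j = 0 of this sum and `collect` yields all the others.
  conv (suc k) (λ i j → det p q (suc k + i) j)
    ≡⟨ conv-cong (suc k) (λ i j → cong₂ (λ x y → det x y (suc k + i) j) p≡ q≡) ⟩
  openCount (suc k) β (b + d) ∎
  where
  open ≡-Reasoning
  b p q : ℕ
  b = suc β
  p = k + b + suc d
  q = k + b
  p≡ : p ≡ suc k + (b + d)
  p≡ = trans (+-suc (k + b) d) (cong suc (+-assoc k b d))
  q≡ : q ≡ suc k + β
  q≡ = +-suc k β
  fringe : ℕ → ℕ → ℕ → ℤ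
  fringe n i j = binom k (suc j) ⊛ binom n (suc k + i)
  swept : ℕ → ℕ → ℤ
  swept i j = (binom p (suc k + i) ⊖ binom q (suc k + i)) ⊛ (binom q (suc j) ⊖ binom k (suc j))
              ⊖ (binom p (suc j) ⊖ binom q (suc j)) ⊛ binom q (suc k + i)
  expand : ∀ n → binom (k + n) (suc (k + k)) ≡
    binom n (suc k + k) ⊕ conv k (fringe n)
  expand n = trans (cong (binom (k + n)) (sym (+-suc k k))) (sym (vandermonde′ k n (suc k)))
  source : Σ[< suc d ] (λ d′ → binom (k + k + (b + d′)) (k + k)) ≡
    (binom p (suc k + k) ⊕ conv k (fringe p))
      ⊖ (binom q (suc k + k) ⊕ conv k (fringe q))
  source = trans
    (Σ-cong (suc d) λ d′ _ → cong (λ z → binom z (k + k))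
      (trans (+-assoc k k (b + d′)) (trans (cong (λ z → k + z) (sym (+-assoc k b d′))) (sym (+-assoc k (k + b) d′)))))
    (trans (hockey-stick (k + (k + b)) (k + k) (suc d))
           (cong₂ _⊖_ (trans (cong (λ z → binom z (suc (k + k))) (+-assoc k (k + b) (suc d))) (expand p))
                      (expand q)))
  sweep : Σ[< suc d ] (λ d′ → Σ[< b ] (λ β′ → openCount k β′ (b + d′))) ≡ conv k swept
  sweep = trans (Σ-cong (suc d) λ d′ _ → Σ-openCount k b (b + d′))
    (trans (Σ-conv (suc d) k _) (conv-cong k λ i j →
      trans (Σ-linear (suc d) (λ d′ → binom (k + (b + d′)) (k + i)) (λ d′ → binom (k + (b + d′)) j) _ _)
            (cong₂ (λ x y → x ⊛ (binom q (suc j) ⊖ binom k (suc j)) ⊖ y ⊛ binom q (suc k + i))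
                   (sweep₁ (k + i)) (sweep₁ j))))
    where
    sweep₁ : ∀ a → Σ[< suc d ] (λ d′ → binom (k + (b + d′)) a) ≡ binom p (suc a) ⊖ binom q (suc a)
    sweep₁ a = trans (Σ-cong (suc d) λ d′ _ → cong (λ z → binom z a) (sym (+-assoc k b d′)))
                     (hockey-stick q a (suc d))
  corner : binom p (suc k + k) ⊖ binom q (suc k + k) ≡ det p q (suc k + k) 0
  corner = trans (units (binom p (suc k + k)) (binom q (suc k + k)))
    (cong₂ (λ x y → binom p (suc k + k) ⊛ x ⊖ y ⊛ binom q (suc k + k)) (sym (binom-zero q)) (sym (binom-zero p)))
    where
    units : ∀ x y → x ⊖ y ≡ x ⊛ 1ℤ ⊖ 1ℤ ⊛ y
    units = solve-∀
  regroup : ∀ x u y v s → ((x ⊕ u) ⊖ (y ⊕ v)) ⊕ s ≡ (x ⊖ y) ⊕ ((u ⊖ v) ⊕ s)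
  regroup = solve-∀
  collect : ∀ κ P Q P′ Q′ →
    (κ ⊛ P ⊖ κ ⊛ Q) ⊕ ((P ⊖ Q) ⊛ (Q′ ⊖ κ) ⊖ (P′ ⊖ Q′) ⊛ Q) ≡ P ⊛ Q′ ⊖ P′ ⊛ Q
  collect = solve-∀

-- By the symmetry C(m, k) = C(m, m - k) the sum of squares is a Vandermonde convolution.
Σ-binom² : ∀ m → Σ[< suc m ] (λ k → binom (k + (m ∸ k)) k ⊛ binom (k + (m ∸ k)) k) ≡ binom (m + m) m
Σ-binom² m = begin
  Σ[< suc m ] (λ k → binom (k + (m ∸ k)) k ⊛ binom (k + (m ∸ k)) k)
    ≡⟨ Σ-cong (suc m) (λ k k<1+m → let k≤m = ≤-pred k<1+m in
         trans (cong (λ z → binom z k ⊛ binom z k) (m+[n∸m]≡n k≤m))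
               (cong (λ z → binom m k ⊛ (+ z)) (nCk≡nC[n∸k] k≤m))) ⟩
  Σ[< suc m ] (λ k → binom m k ⊛ binom m (m ∸ k))
    ≡⟨ Σ-as-conv m (λ j i → binom m j ⊛ binom m i) ⟩
  conv (suc m) (λ i j → binom m j ⊛ binom m i)
    ≡⟨ vandermonde m m 0 ⟩
  binom (m + m) (m + 0)
    ≡⟨ cong (binom (m + m)) (+-identityʳ m) ⟩
  binom (m + m) m ∎
  where open ≡-Reasoning

-- Convex polyominoes as sequences of columns

column : (h b t : ℕ) → Vec Bool h
column h b t = tabulate (λ i → (b ≤ᵇ toℕ i) ∧ (toℕ i ≤ᵇ t))

atCol-tabulate : ∀ h (f : ℕ → Bool) y → y < h → atCol (tabulate {n = h} (f ∘ toℕ)) y ≡ f y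
atCol-tabulate (suc h) f zero    _         = refl
atCol-tabulate (suc h) f (suc y) (s≤s y<h) = atCol-tabulate h (f ∘ suc) y y<h

atCol-< : ∀ {h} (c : Vec Bool h) y → atCol c y ≡ true → y < h
atCol-< (b ∷ c) zero    _ = s≤s z≤n
atCol-< (b ∷ c) (suc y) p = s≤s (atCol-< c y p)

atCol-ext : ∀ {h} (c d : Vec Bool h) → (∀ y → y < h → atCol c y ≡ atCol d y) → c ≡ d
atCol-ext []      []      e = refl
atCol-ext (x ∷ c) (y ∷ d) e = cong₂ _∷_ (e 0 (s≤s z≤n)) (atCol-ext c d (λ y y<h → e (suc y) (s≤s y<h)))

column⁺ : ∀ {h b t y} → t < h → b ≤ y → y ≤ t → atCol (column h b t) y ≡ true
column⁺ {h} {b} {t} {y} t<h b≤y y≤t =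
  trans (atCol-tabulate h (λ i → (b ≤ᵇ i) ∧ (i ≤ᵇ t)) y (≤-<-trans y≤t t<h))
        (Equivalence.to T-≡ (Equivalence.from T-∧ (≤⇒≤ᵇ b≤y , ≤⇒≤ᵇ y≤t)))

column⁻ : ∀ {h b t y} → atCol (column h b t) y ≡ true → b ≤ y × y ≤ t
column⁻ {h} {b} {t} {y} p = ≤ᵇ⇒≤ b y (proj₁ q) , ≤ᵇ⇒≤ y t (proj₂ q)
  where
  q : T (b ≤ᵇ y) × T (y ≤ᵇ t)
  q = Equivalence.to T-∧ (Equivalence.from T-≡
        (trans (sym (atCol-tabulate h (λ i → (b ≤ᵇ i) ∧ (i ≤ᵇ t)) y (atCol-< (column h b t) y p))) p))

-- Both intervals are nonempty, so each contains the end points of the other.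
column-injective : ∀ {h b t b′ t′} → b ≤ t → t < h → b′ ≤ t′ → t′ < h →
  (∀ y → atCol (column h b t) y ≡ atCol (column h b′ t′) y) → b ≡ b′ × t ≡ t′
column-injective {h} {b} {t} {b′} {t′} b≤t t<h b′≤t′ t′<h e =
  ≤-antisym (proj₁ (right (column⁺ t′<h ≤-refl b′≤t′))) (proj₁ (left (column⁺ t<h ≤-refl b≤t))) ,
  ≤-antisym (proj₂ (left (column⁺ t<h b≤t ≤-refl))) (proj₂ (right (column⁺ t′<h b′≤t′ ≤-refl)))
  where
  left : ∀ {y} → atCol (column h b t) y ≡ true → b′ ≤ y × y ≤ t′
  left p = column⁻ {h} (trans (sym (e _)) p)
  right : ∀ {y} → atCol (column h b′ t′) y ≡ true → b ≤ y × y ≤ t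
  right p = column⁻ {h} (trans (e _) p)

extremes : ∀ {h} (c : Vec Bool h) → (∀ y → atCol c y ≡ false) ⊎
  ∃₂ λ b t → atCol c b ≡ true × atCol c t ≡ true × (∀ y → atCol c y ≡ true → b ≤ y × y ≤ t)
extremes [] = inj₁ (λ _ → refl)
extremes (false ∷ c) with extremes c
... | inj₁ none = inj₁ λ { zero → refl ; (suc y) → none y }
... | inj₂ (b , t , pb , pt , range) = inj₂ (suc b , suc t , pb , pt , λ where
  (suc y) p → s≤s (proj₁ (range y p)) , s≤s (proj₂ (range y p)))
extremes (true ∷ c) with extremes c
... | inj₁ none = inj₂ (0 , 0 , refl , refl , λ where
  zero p → z≤n , z≤n
  (suc y) p → case trans (sym p) (none y) of λ ())
... | inj₂ (b , t , pb , pt , range) = inj₂ (0 , suc t , refl , pt , λ where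
  zero p → z≤n , z≤n
  (suc y) p → z≤n , s≤s (proj₂ (range y p)))

-- The extreme occupied rows bound the column, and convexity fills everything between them.
interval : ∀ {h} (c : Vec Bool h) →
  (∀ y₁ y y₂ → atCol c y₁ ≡ true → atCol c y₂ ≡ true → y₁ ≤ y → y ≤ y₂ → atCol c y ≡ true) →
  (∃ λ y → atCol c y ≡ true) → ∃₂ λ b t → b ≤ t × t < h × c ≡ column h b t
interval {h} c convex (y , p) with extremes c
... | inj₁ none with () ← trans (sym p) (none y)
... | inj₂ (b , t , pb , pt , range) =
  b , t , proj₁ (range t pt) , t<h , atCol-ext c (column h b t) (λ y _ → agree y)
  where
  t<h : t < h
  t<h = atCol-< c t pt
  agree : ∀ y → atCol c y ≡ atCol (column h b t) y
  agree y with atCol c y in eq | atCol (column h b t) y in eq′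
  ... | true  | true  = refl
  ... | false | false = refl
  ... | true  | false = trans (sym (column⁺ t<h (proj₁ (range y eq)) (proj₂ (range y eq)))) eq′
  ... | false | true  = trans (sym eq)
    (convex b y t pb pt (proj₁ (column⁻ {h} {b} {t} eq′)) (proj₂ (column⁻ {h} {b} {t} eq′)))

In-width : ∀ {w h} (g : Vec (Vec Bool h) w) x y → In (w , h , g) x y → x < w
In-width (c ∷ g) zero    y p = s≤s z≤n
In-width (c ∷ g) (suc x) y p = s≤s (In-width g x y p)

In-height : ∀ {w h} (g : Vec (Vec Bool h) w) x y → In (w , h , g) x y → y < h
In-height (c ∷ g) zero    y p = atCol-< c y p
In-height (c ∷ g) (suc x) y p = In-height g x y p

-- Cell paths and growth column by column

path-source : ∀ {P x y x′ y′} → CellPath P x y x′ y′ → In P x y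
path-source (here p)     = p
path-source (step p _ _) = p

_◅◅_ : ∀ {P x y x₁ y₁ x₂ y₂} → CellPath P x y x₁ y₁ → CellPath P x₁ y₁ x₂ y₂ → CellPath P x y x₂ y₂
here _     ◅◅ q = q
step i a p ◅◅ q = step i a (p ◅◅ q)

Adjacent-sym : ∀ {x y x′ y′} → Adjacent x y x′ y′ → Adjacent x′ y′ x y
Adjacent-sym (east x y)  = west x y
Adjacent-sym (west x y)  = east x y
Adjacent-sym (north x y) = south x y
Adjacent-sym (south x y) = north x y

path-sym : ∀ {P x y x′ y′} → CellPath P x y x′ y′ → CellPath P x′ y′ x y
path-sym (here p)     = here p
path-sym (step p a q) = path-sym q ◅◅ step (path-source q) (Adjacent-sym a) (here p)

path-shift : ∀ {w h} {c : Vec Bool h} {g : Vec (Vec Bool h) w} {x y x′ y′} →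
  CellPath (w , h , g) x y x′ y′ → CellPath (suc w , h , c ∷ g) (suc x) y (suc x′) y′
path-shift (here p) = here p
path-shift {w} {h} {c} {g} (step p a q) = step p (shift a) (path-shift q)
  where
  shift : ∀ {x y x′ y′} → Adjacent x y x′ y′ → Adjacent (suc x) y (suc x′) y′
  shift (east x y)  = east (suc x) y
  shift (west x y)  = west (suc x) y
  shift (north x y) = north (suc x) y
  shift (south x y) = south (suc x) y

vertical : ∀ {P x y} d → (∀ y′ → y ≤ y′ → y′ ≤ d + y → In P x y′) → CellPath P x y x (d + y)
vertical zero    p = here (p _ ≤-refl ≤-refl)
vertical (suc d) p =
  vertical d (λ y′ l u → p y′ l (m≤n⇒m≤1+n u)) ◅◅
  step (p _ (m≤n+m _ d) (n≤1+n _)) (north _ _) (here (p _ (m≤n+m _ (suc d)) ≤-refl))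

-- The union of columns grown leftwards from the root column, whose top cell is
-- the NE corner of the box; [b , t] is the leftmost column and l the lowest row
-- reached.
record Grown {h w} (g : Vec (Vec Bool h) (suc w)) (l b t : ℕ) : Set where
  P : Shape
  P = suc w , h , g
  field
    b≤t       : b ≤ t
    t<h       : t < h
    head⁺     : ∀ {y} → b ≤ y → y ≤ t → In P 0 y
    head⁻     : ∀ {y} → In P 0 y → b ≤ y × y ≤ t
    floor     : ∀ x y → In P x y → l ≤ y
    cover     : ∀ y → l ≤ y → y < h → ∃ λ x → In P x y
    occupied  : ∀ x → x < suc w → ∃ λ y → In P x y
    colConvex : ∀ x y₁ y y₂ → In P x y₁ → In P x y₂ → y₁ ≤ y → y ≤ y₂ → In P x y
    rowConvex : ∀ x₁ x x₂ y → In P x₁ y → In P x₂ y → x₁ ≤ x → x ≤ x₂ → In P x y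
    rise      : ∀ x x′ y → x ≤ x′ → x′ < suc w → In P x y → ∃ λ y′ → y ≤ y′ × In P x′ y′
    corner    : ∀ y → suc y ≡ h → In P w y
    connected : ∀ x y → In P x y → CellPath P 0 t x y

column-path : ∀ {w h b t y} {g : Vec (Vec Bool h) w} → t < h → b ≤ y → y ≤ t →
  CellPath (suc w , h , column h b t ∷ g) 0 y 0 t
column-path {w} {h} {b} {t} {y} {g} t<h b≤y y≤t =
  subst (λ z → CellPath (suc w , h , column h b t ∷ g) 0 y 0 z) (m∸n+n≡m y≤t)
    (vertical (t ∸ y) λ y′ y≤y′ y′≤ →
      column⁺ t<h (≤-trans b≤y y≤y′) (≤-trans y′≤ (≤-reflexive (m∸n+n≡m y≤t))))

grown-root : ∀ {h b t} → b ≤ t → suc t ≡ h → Grown (column h b t ∷ []) b b t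
grown-root {h} {b} {t} b≤t refl = record
  { b≤t = b≤t
  ; t<h = ≤-refl
  ; head⁺ = column⁺ ≤-refl
  ; head⁻ = column⁻ {h}
  ; floor = λ { zero y p → proj₁ (column⁻ {h} {b} {t} p) }
  ; cover = λ y b≤y y<h → 0 , column⁺ ≤-refl b≤y (≤-pred y<h)
  ; occupied = λ { zero _ → b , column⁺ ≤-refl ≤-refl b≤t ; (suc x) (s≤s ()) }
  ; colConvex = λ { zero y₁ y y₂ p q l u →
      column⁺ ≤-refl (≤-trans (proj₁ (column⁻ {h} {b} {t} p)) l)
                     (≤-trans u (proj₂ (column⁻ {h} {b} {t} q))) }
  ; rowConvex = λ { zero zero zero y p q l u → p }
  ; rise = λ { zero zero y _ _ p → y , ≤-refl , p ; _ (suc x) y _ (s≤s ()) p }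
  ; corner = λ { y refl → column⁺ ≤-refl b≤t ≤-refl }
  ; connected = λ { zero y p → path-sym
      (column-path ≤-refl (proj₁ (column⁻ {h} {b} {t} p)) (proj₂ (column⁻ {h} {b} {t} p))) }
  }

-- Serves both phases. The new top `t′` lies in the old leftmost column, which gives connectedness
-- and keeps the tops rising eastwards. `above` forces a row of the new column that recurs further
-- east through the old leftmost column, as row convexity demands; `below` makes the new column fill
-- every row reached for the first time.
grown-step : ∀ {h w l b t l′ b′ t′} {g : Vec (Vec Bool h) (suc w)} → Grown g l b t →
  b′ ≤ t′ → t′ ≤ t → b ≤ t′ → l′ ≤ l → l′ ≤ b′ →
  (∀ y → b′ ≤ y → l ≤ y → b ≤ y) →
  (∀ y → l′ ≤ y → y < l → b′ ≤ y × y ≤ t′) →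
  Grown (column h b′ t′ ∷ g) l′ b′ t′
grown-step {h} {w} {l} {b} {t} {l′} {b′} {t′} {g} G b′≤t′ t′≤t b≤t′ l′≤l l′≤b′ above below = record
  { b≤t = b′≤t′
  ; t<h = t′<h
  ; head⁺ = column⁺ t′<h
  ; head⁻ = new⁻
  ; floor = λ { zero y p → ≤-trans l′≤b′ (proj₁ (new⁻ p))
              ; (suc x) y p → ≤-trans l′≤l (G.floor x y p) }
  ; cover = cover
  ; occupied = λ { zero _ → b′ , column⁺ t′<h ≤-refl b′≤t′ ; (suc x) (s≤s x<w) → G.occupied x x<w }
  ; colConvex = λ { zero y₁ y y₂ p q i j →
                      column⁺ t′<h (≤-trans (proj₁ (new⁻ p)) i) (≤-trans j (proj₂ (new⁻ q)))
                  ; (suc x) → G.colConvex x }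
  ; rowConvex = rowConvex
  ; rise = rise
  ; corner = G.corner
  ; connected = connected
  }
  where
  module G = Grown G
  P : Shape
  P = suc (suc w) , h , column h b′ t′ ∷ g
  t′<h : t′ < h
  t′<h = ≤-<-trans t′≤t G.t<h
  new⁻ : ∀ {y} → In P 0 y → b′ ≤ y × y ≤ t′
  new⁻ = column⁻ {h}
  cover : ∀ y → l′ ≤ y → y < h → ∃ λ x → In P x y
  cover y l′≤y y<h with l ≤? y
  ... | yes l≤y = let (x , p) = G.cover y l≤y y<h in suc x , p
  ... | no  l≰y = let (i , j) = below y l′≤y (≰⇒> l≰y) in 0 , column⁺ t′<h i j
  rowConvex : ∀ x₁ x x₂ y → In P x₁ y → In P x₂ y → x₁ ≤ x → x ≤ x₂ → In P x y
  rowConvex zero zero x₂ y p q i j = p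
  rowConvex zero (suc x) (suc x₂) y p q i (s≤s j) = G.rowConvex 0 x x₂ y
    (G.head⁺ (above y (proj₁ (new⁻ p)) (G.floor x₂ y q)) (≤-trans (proj₂ (new⁻ p)) t′≤t)) q z≤n j
  rowConvex (suc x₁) (suc x) (suc x₂) y p q (s≤s i) (s≤s j) = G.rowConvex x₁ x x₂ y p q i j
  rise : ∀ x x′ y → x ≤ x′ → x′ < suc (suc w) → In P x y → ∃ λ y′ → y ≤ y′ × In P x′ y′
  rise zero zero y _ _ p = y , ≤-refl , p
  rise zero (suc x′) y _ (s≤s x′<w) p =
    let (y′ , t≤y′ , q) = G.rise 0 x′ t z≤n x′<w (G.head⁺ G.b≤t ≤-refl)
    in y′ , ≤-trans (≤-trans (proj₂ (new⁻ p)) t′≤t) t≤y′ , q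
  rise (suc x) (suc x′) y (s≤s i) (s≤s x′<w) p = G.rise x x′ y i x′<w p
  t′∈head : In (suc w , h , g) 0 t′
  t′∈head = G.head⁺ b≤t′ t′≤t
  connected : ∀ x y → In P x y → CellPath P 0 t′ x y
  connected zero y p = path-sym (column-path t′<h (proj₁ (new⁻ p)) (proj₂ (new⁻ p)))
  connected (suc x) y p = step (column⁺ t′<h b′≤t′ ≤-refl) (east 0 t′)
    (path-shift (path-sym (G.connected 0 t′ t′∈head) ◅◅ G.connected x y p))

-- The bottom of the leftmost column is suc β: row 0 has not been reached.
data Open {h : ℕ} : ∀ {w} → Vec (Vec Bool h) (suc w) → ℕ → ℕ → Set where
  root : ∀ {β t} → β < t → suc t ≡ h → Open (column h (suc β) t ∷ []) β t
  grow : ∀ {w β t β′ t′} {g : Vec (Vec Bool h) (suc w)} → Open g β t →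
         β′ ≤ β → β < t′ → t′ ≤ t → Open (column h (suc β′) t′ ∷ g) β′ t′

-- Once row 0 is occupied, bottoms never descend again on the way west; `close` is the one passage
-- between the phases.
data Closed {h : ℕ} : ∀ {w} → Vec (Vec Bool h) (suc w) → ℕ → ℕ → Set where
  root  : ∀ {t} → suc t ≡ h → Closed (column h 0 t ∷ []) 0 t
  close : ∀ {w β t t′} {g : Vec (Vec Bool h) (suc w)} → Open g β t →
          β < t′ → t′ ≤ t → Closed (column h 0 t′ ∷ g) 0 t′
  grow  : ∀ {w b t b′ t′} {g : Vec (Vec Bool h) (suc w)} → Closed g b t →
          b ≤ b′ → b′ ≤ t′ → t′ ≤ t → Closed (column h b′ t′ ∷ g) b′ t′

-- The leftmost column of an open grid reaches its lowest row, so its bottom is also the floor.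
Open⇒Grown : ∀ {h w β t} {g : Vec (Vec Bool h) (suc w)} → Open g β t → Grown g (suc β) (suc β) t
Open⇒Grown (root β<t e) = grown-root β<t e
Open⇒Grown (grow o β′≤β β<t′ t′≤t) =
  grown-step (Open⇒Grown o) (≤-trans (s≤s β′≤β) β<t′) t′≤t β<t′ (s≤s β′≤β) ≤-refl
    (λ _ _ l≤y → l≤y) (λ _ l′≤y y<l → l′≤y , ≤-trans (<⇒≤ y<l) β<t′)

Closed⇒Grown : ∀ {h w b t} {g : Vec (Vec Bool h) (suc w)} → Closed g b t → Grown g 0 b t
Closed⇒Grown (root e) = grown-root z≤n e
Closed⇒Grown (close o β<t′ t′≤t) =
  grown-step (Open⇒Grown o) z≤n t′≤t β<t′ z≤n z≤n
    (λ _ _ l≤y → l≤y) (λ _ l′≤y y<l → l′≤y , ≤-trans (<⇒≤ y<l) β<t′)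
Closed⇒Grown (grow c b≤b′ b′≤t′ t′≤t) =
  grown-step (Closed⇒Grown c) b′≤t′ t′≤t (≤-trans b≤b′ b′≤t′) z≤n z≤n
    (λ _ b′≤y _ → ≤-trans b≤b′ b′≤y) (λ _ _ ())

-- Closed grids are ascending and rectangular

NW-ends : ∀ {P x y s x′ y′} → NWPath P x y s x′ y′ → In P x y × In P x′ y′ × x′ ≤ x × y ≤ y′
NW-ends (done p) = p , p , ≤-refl , ≤-refl
NW-ends (stepN p q) = let (_ , r , i , j) = NW-ends q in p , r , i , <⇒≤ j
NW-ends (stepW p q) = let (_ , r , i , j) = NW-ends q in p , r , m≤n⇒m≤1+n i , j

west-path : ∀ {P y} d x → (∀ x′ → x ≤ x′ → x′ ≤ d + x → In P x′ y) →
  NWPath P (d + x) y (replicate d W) x y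
west-path zero    x p = done (p x ≤-refl ≤-refl)
west-path (suc d) x p =
  stepW (p _ (m≤n+m x (suc d)) ≤-refl) (west-path d x (λ x′ i j → p x′ i (m≤n⇒m≤1+n j)))

north-path : ∀ {P x s x′ y′} d y → (∀ z → y ≤ z → z ≤ d + y → In P x z) →
  NWPath P x (d + y) s x′ y′ → NWPath P x y (replicate d N ++ s) x′ y′
north-path zero    y p q = q
north-path {P} {x} {s} {x′} {y′} (suc d) y p q =
  stepN (p y ≤-refl (m≤n+m y (suc d)))
        (north-path d (suc y) (λ z i j → p z (<⇒≤ i) (≤-trans j (≤-reflexive (+-suc d y))))
                    (subst (λ z → NWPath P x z s x′ y′) (sym (+-suc d y)) q))

changesFrom-W : ∀ e → changesFrom W (replicate e W) ≡ 0
changesFrom-W zero    = refl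
changesFrom-W (suc e) = changesFrom-W e

changesFrom-N : ∀ d e → changesFrom N (replicate d N ++ replicate e W) ≤ 1
changesFrom-N zero    zero    = z≤n
changesFrom-N zero    (suc e) = s≤s (≤-reflexive (changesFrom-W e))
changesFrom-N (suc d) e       = changesFrom-N d e

changes-NW : ∀ d e → changes (replicate d N ++ replicate e W) ≤ 1
changes-NW zero    zero    = z≤n
changes-NW zero    (suc e) = ≤-trans (≤-reflexive (changesFrom-W e)) z≤n
changes-NW (suc d) e       = changesFrom-N d e

Valid : Shape → Set
Valid P = MinimalBox P × Ascending P × Rectangular P

Grown⇒DNW≤1 : ∀ {h w b t} {g : Vec (Vec Bool h) (suc w)} → Grown g 0 b t → DNW≤1 (suc w , h , g)
Grown⇒DNW≤1 {h} {w} {g = g} G x y x′ y′ s π =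
  replicate (y′ ∸ y) N ++ replicate (x ∸ x′) W , path , changes-NW (y′ ∸ y) (x ∸ x′)
  where
  open Grown G
  source : In P x y
  source = proj₁ (NW-ends π)
  target : In P x′ y′
  target = proj₁ (proj₂ (NW-ends π))
  x′≤x : x′ ≤ x
  x′≤x = proj₁ (proj₂ (proj₂ (NW-ends π)))
  y≤y′ : y ≤ y′
  y≤y′ = proj₂ (proj₂ (proj₂ (NW-ends π)))
  northOf : ∀ z → y ≤ z → z ≤ y′ → In P x z
  northOf z y≤z z≤y′ =
    -- Tops do not decrease eastwards, so column `x` extends at least to row `y′`, and column
    -- convexity fills the way there.
    let (top , y′≤top , p) = rise x′ x y′ x′≤x (In-width g x y source) target
    in colConvex x y z top source p y≤z (≤-trans z≤y′ y′≤top)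
  path : NWPath P x y (replicate (y′ ∸ y) N ++ replicate (x ∸ x′) W) x′ y′
  path = north-path (y′ ∸ y) y (λ z i j → northOf z i (≤-trans j (≤-reflexive (m∸n+n≡m y≤y′))))
    (subst (λ z → NWPath P x z _ x′ y′) (sym (m∸n+n≡m y≤y′))
      (subst (λ z → NWPath P z y′ (replicate (x ∸ x′) W) x′ y′) (m∸n+n≡m x′≤x)
        (west-path (x ∸ x′) x′ λ z i j → rowConvex x′ z x y′ target (northOf y′ y≤y′ ≤-refl) i
          (≤-trans j (≤-reflexive (m∸n+n≡m x′≤x))))))

Closed⇒Valid : ∀ {h w b t} {g : Vec (Vec Bool h) (suc w)} → Closed g b t → Valid (suc w , h , g)
Closed⇒Valid {zero} c with () ← Grown.t<h (Closed⇒Grown c)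
Closed⇒Valid {suc h} {w} {b} {t} {g} c =
  (occupied , λ y y<h → cover y z≤n y<h) ,
  (((0 , b , head⁺ ≤-refl b≤t) ,
    λ x y x′ y′ p q → path-sym (connected x y p) ◅◅ connected x′ y′ q) ,
   (rowConvex , colConvex) ,
   Grown⇒DNW≤1 (Closed⇒Grown c)) ,
  (w , h , corner h refl ,
   (λ x y p → ≤-pred (In-width g x y p)) ,
   (λ y p → ≤-pred (In-height g w y p)) ,
   (λ x y p → ≤-pred (In-height g x y p)))
  where open Grown (Closed⇒Grown c)

-- Valid polyominoes are grown column by column

-- Between two cells (x₀ , y₀) and (X , Y) of a row-convex polyomino every column
-- contains a cell at an intermediate height.  The order ≲ is ≤ or its converse.
module Between (P : Shape)
  (rowConvex : ∀ x₁ x x₂ y → In P x₁ y → In P x₂ y → x₁ ≤ x → x ≤ x₂ → In P x y)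
  (_≲_ : ℕ → ℕ → Set)
  (≲-refl : Reflexive _≲_) (≲-antisym : Antisymmetric _≡_ _≲_) (≲-total : Total _≲_)
  (≲-up   : ∀ {v y} → v ≲ y → suc v ≲ y ⊎ v ≡ y)
  (≲-down : ∀ {v y} → suc v ≲ y → v ≲ y ⊎ suc v ≡ y)
  where

  data Near : ℕ → ℕ → Set where
    up   : ∀ {v} → Near v (suc v)
    down : ∀ {v} → Near (suc v) v

  near : ∀ {v v′ y} → Near v v′ → v ≲ y → v′ ≲ y ⊎ v ≡ y
  near up   = ≲-up
  near down = ≲-down

  module _ {x₀ y₀ x X Y : ℕ} (p₀ : In P x₀ y₀) (p₁ : In P X Y)
           (x₀≤x : x₀ ≤ x) (x≤X : x ≤ X) (y₀≲Y : y₀ ≲ Y) where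

    Found : Set
    Found = ∃ λ y → y₀ ≲ y × y ≲ Y × In P x y

    -- The walk is outside the strip on the side of y₀, or inside it and not yet
    -- past column x.
    State : ℕ → ℕ → Set
    State u v = v ≲ y₀ ⊎ (y₀ ≲ v × v ≲ Y × u ≤ x)

    in-row-y₀ : ∀ {u} → x ≤ u → In P u y₀ → Found
    in-row-y₀ {u} x≤u p = y₀ , ≲-refl , y₀≲Y , rowConvex x₀ x u y₀ p₀ p x₀≤x x≤u

    in-row-Y : ∀ {u} → u ≤ x → In P u Y → Found
    in-row-Y {u} u≤x p = Y , y₀≲Y , ≲-refl , rowConvex u x X Y p p₁ u≤x x≤X

    horizontal : ∀ {u u′ v} → In P u v → (u < x → u′ ≤ x) → State u v → Found ⊎ State u′ v
    horizontal p f (inj₁ below) = inj₂ (inj₁ below)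
    horizontal p f (inj₂ (i , j , u≤x)) with m≤n⇒m<n∨m≡n u≤x
    ... | inj₁ u<x  = inj₂ (inj₂ (i , j , f u<x))
    ... | inj₂ refl = inj₁ (_ , i , j , p)

    inside : ∀ {u v v′} → In P u v → Near v v′ → v ≲ Y → u ≤ x → Found ⊎ State u v′
    inside {v′ = v′} p n v≲Y u≤x with near n v≲Y
    ... | inj₂ refl = inj₁ (in-row-Y u≤x p)
    ... | inj₁ v′≲Y with ≲-total y₀ v′
    ...   | inj₁ i = inj₂ (inj₂ (i , v′≲Y , u≤x))
    ...   | inj₂ i = inj₂ (inj₁ i)

    sideways : ∀ {u v v′} → In P u v → Near v v′ → State u v → Found ⊎ State u v′
    sideways p n (inj₂ (_ , v≲Y , u≤x)) = inside p n v≲Y u≤x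
    sideways {u} p n (inj₁ v≲y₀) with near n v≲y₀
    ... | inj₁ v′≲y₀ = inj₂ (inj₁ v′≲y₀)
    ... | inj₂ refl with ≤-total u x
    ...   | inj₁ u≤x = inside p n y₀≲Y u≤x
    ...   | inj₂ x≤u = inj₁ (in-row-y₀ x≤u p)

    transition : ∀ {u v u′ v′} → In P u v → Adjacent u v u′ v′ → State u v → Found ⊎ State u′ v′
    transition p (east x y)  = horizontal p (λ u<x → u<x)
    transition p (west x y)  = horizontal p (λ u<x → <⇒≤ (<⇒≤ u<x))
    transition p (north x y) = sideways p up
    transition p (south x y) = sideways p down

    -- The invariant `State` can fail only by stepping east out of column `x` within the strip, by
    -- crossing row `Y` at or west of `x`, or by entering through row `y₀` at or east of `x`. The
    -- first exhibits a cell; the others give one by row convexity with (X , Y) or (x₀ , y₀). If it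
    -- never fails, its value at (X , Y) forces Y = y₀ or X ≤ x, and row convexity applies again.
    walk : ∀ {u v} → CellPath P u v X Y → State u v → Found
    walk (here p) (inj₁ Y≲y₀) rewrite ≲-antisym y₀≲Y Y≲y₀ = Y , ≲-refl , ≲-refl , rowConvex x₀ x X Y p₀ p x₀≤x x≤X
    walk (here p) (inj₂ (_ , _ , X≤x)) = in-row-Y X≤x p
    walk (step p a q) s with transition p a s
    ... | inj₁ found = found
    ... | inj₂ s′    = walk q s′

-- Some step of the path goes east out of column `x`, and its two ends lie in one row.
crossing : ∀ {P x u v X Y} → CellPath P u v X Y → u ≤ x → x < X → ∃ λ r → In P x r × In P (suc x) r
crossing (here p) u≤x x<X = ⊥-elim (<⇒≱ x<X u≤x)
crossing (step p (east u v) q) u≤x x<X with m≤n⇒m<n∨m≡n u≤x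
... | inj₁ u<x  = crossing q u<x x<X
... | inj₂ refl = v , p , path-source q
crossing (step p (west u v) q)  u≤x x<X = crossing q (<⇒≤ u≤x) x<X
crossing (step p (north u v) q) u≤x x<X = crossing q u≤x x<X
crossing (step p (south u v) q) u≤x x<X = crossing q u≤x x<X

-- Consequences of validity that survive the removal of the leftmost column.
record Profile {h w} (g : Vec (Vec Bool h) (suc w)) : Set where
  P : Shape
  P = suc w , h , g
  field
    colConvex : ∀ x y₁ y y₂ → In P x y₁ → In P x y₂ → y₁ ≤ y → y ≤ y₂ → In P x y
    occupied  : ∀ x → x ≤ w → ∃ λ y → In P x y
    rise      : ∀ x y → x < w → In P x y → ∃ λ y′ → y ≤ y′ × In P (suc x) y′
    corner    : ∀ y → suc y ≡ h → In P w y
    shared   : ∀ x → x < w → ∃ λ r → In P x r × In P (suc x) r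
    fall      : ∀ x x′ y → x < x′ → In P x′ 0 → In P x y → ∃ λ y′ → y′ ≤ y × In P (suc x) y′
    sink      : ∀ x → x < w → (∃ λ x′ → x < x′ × In P x′ 0) ⊎
                  (∀ y → In P (suc x) y → ∃ λ y′ → y′ ≤ y × In P x y′)

Profile-tail : ∀ {h w} {c : Vec Bool h} {g : Vec (Vec Bool h) (suc w)} → Profile (c ∷ g) → Profile g
Profile-tail {h} {w} {c} {g} Q = record
  { colConvex = λ x → colConvex (suc x)
  ; occupied  = λ x x≤w → occupied (suc x) (s≤s x≤w)
  ; rise      = λ x y x<w → rise (suc x) y (s≤s x<w)
  ; corner    = corner
  ; shared   = λ x x<w → shared (suc x) (s≤s x<w)
  ; fall      = λ x x′ y x<x′ → fall (suc x) (suc x′) y (s≤s x<x′)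
  ; sink      = λ x x<w → sink′ (sink (suc x) (s≤s x<w))
  }
  where
  open Profile Q
  sink′ : ∀ {x} {A : Set} → (∃ λ x′ → suc x < x′ × In P x′ 0) ⊎ A →
    (∃ λ x′ → x < x′ × In (suc w , h , g) x′ 0) ⊎ A
  sink′ (inj₁ (suc x′ , s≤s i , p)) = inj₁ (x′ , i , p)
  sink′ (inj₂ f) = inj₂ f

first-column : ∀ {h w} {c : Vec Bool h} {g : Vec (Vec Bool h) w} → Profile (c ∷ g) →
  ∃₂ λ b t → b ≤ t × t < h × c ≡ column h b t
first-column {c = c} Q = interval c (colConvex 0) (occupied 0 z≤n)
  where open Profile Q

-- Induction from the last column. `rise` bounds the new top from above. If the tail is closed,
-- `fall` bounds the new bottom from below; if it is open, `shared` keeps the new top above β and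
-- `sink` keeps the new bottom at most β + 1.
Profile⇒Closed⊎Open : ∀ {h w} (g : Vec (Vec Bool h) (suc w)) → Profile g →
  (∃₂ λ b t → Closed g b t) ⊎ (∃₂ λ β t → Open g β t)
Profile⇒Closed⊎Open {zero} g Q
  with y , p ← Profile.occupied Q 0 z≤n
  with () ← In-height g 0 y p
Profile⇒Closed⊎Open {suc h} (c ∷ []) Q with first-column Q
... | b , t , b≤t , s≤s t≤h , refl
  -- The NE corner fixes the top of a single column; its bottom then decides the phase.
  with ≤-antisym t≤h (proj₂ (column⁻ {suc h} {b} (Profile.corner Q h refl)))
Profile⇒Closed⊎Open {suc h} (c ∷ []) Q | zero  , _ , b≤t , _ , refl | refl = inj₁ (_ , _ , root refl)
Profile⇒Closed⊎Open {suc h} (c ∷ []) Q | suc β , _ , b≤t , _ , refl | refl = inj₂ (_ , _ , root b≤t refl)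
Profile⇒Closed⊎Open {h} (c ∷ g@(_ ∷ _)) Q
  with first-column Q | Profile⇒Closed⊎Open g (Profile-tail Q)
... | b′ , t′ , b′≤t′ , t′<h , refl | inj₁ (b , t , cl) =
  inj₁ (_ , _ , grow cl b≤b′ b′≤t′ t′≤t)
  where
  module G = Grown (Closed⇒Grown cl)
  open Profile Q
  t′≤t : t′ ≤ t
  t′≤t = let (_ , i , p) = rise 0 t′ (s≤s z≤n) (column⁺ t′<h b′≤t′ ≤-refl) in ≤-trans i (proj₂ (G.head⁻ p))
  b≤b′ : b ≤ b′
  -- A closed tail has a cell in row 0, which is the premise of `fall`.
  b≤b′ = let (x , p) = G.cover 0 z≤n (≤-<-trans z≤n t′<h)
             (_ , i , q) = fall 0 (suc x) b′ (s≤s z≤n) p (column⁺ t′<h ≤-refl b′≤t′)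
         in ≤-trans (proj₁ (G.head⁻ q)) i
... | b′ , t′ , b′≤t′ , t′<h , refl | inj₂ (β , t , op) = attach b′ b′≤1+β refl
  where
  module G = Grown (Open⇒Grown op)
  open Profile Q
  t′≤t : t′ ≤ t
  t′≤t = let (_ , i , p) = rise 0 t′ (s≤s z≤n) (column⁺ t′<h b′≤t′ ≤-refl) in ≤-trans i (proj₂ (G.head⁻ p))
  β<t′ : β < t′
  β<t′ = let (_ , p , q) = shared 0 (s≤s z≤n) in ≤-trans (proj₁ (G.head⁻ q)) (proj₂ (column⁻ {h} {b′} {t′} p))
  b′≤1+β : b′ ≤ suc β
  b′≤1+β with sink 0 (s≤s z≤n)
  -- An open tail lies strictly above row 0.
  ... | inj₁ (suc x , _ , p) with () ← G.floor x 0 p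
  ... | inj₂ f = let (_ , i , p) = f (suc β) (G.head⁺ ≤-refl G.b≤t) in ≤-trans (proj₁ (column⁻ {h} {b′} {t′} p)) i
  attach : ∀ b″ → b″ ≤ suc β → b″ ≡ b′ →
    (∃₂ λ b t → Closed (column h b′ t′ ∷ g) b t) ⊎ (∃₂ λ β t → Open (column h b′ t′ ∷ g) β t)
  attach zero     _         refl = inj₁ (_ , _ , close op β<t′ t′≤t)
  attach (suc β′) (s≤s i)   refl = inj₂ (_ , _ , grow op i β<t′ t′≤t)

-- `rise` follows a walk to the NE corner, `fall` a walk to a cell of row 0, and the second
-- alternative of `sink` a walk from such a cell; in each case `Between` supplies the cell in the
-- intermediate column.
Valid⇒Profile : ∀ {h w} (g : Vec (Vec Bool h) (suc w)) → Valid (suc w , h , g) → Profile g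
Valid⇒Profile {h} {w} g ((cols , rows) , ((_ , connected) , (rowConvex , colConvex) , _) ,
                          (X , Y , pXY , rightmost , _ , topmost)) = record
  { colConvex = colConvex
  ; occupied = λ x x≤w → cols x (s≤s x≤w)
  ; rise = λ x y x<w p →
      let (y′ , i , _ , q) = Rising.walk p top (n≤1+n x) x<w (≤-height p) (connected _ _ _ _ p top)
                               (inj₁ ≤-refl)
      in y′ , i , q
  ; corner = λ y e → subst (In P w) (suc-injective (trans (≤-antisym (In-height g X Y pXY) h≤1+Y) (sym e))) top
  ; shared = λ x x<w → let (y , p) = cols x (≤-trans x<w (n≤1+n w)) in
      crossing (connected _ _ _ _ p top) ≤-refl x<w
  ; fall = λ x x′ y x<x′ p q →
      let (y′ , i , _ , r) = Falling.walk q p (n≤1+n x) x<x′ z≤n (connected _ _ _ _ q p) (inj₁ ≤-refl)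
      in y′ , i , r
  ; sink = sink
  }
  where
  P : Shape
  P = suc w , h , g
  X≡w : X ≡ w
  X≡w = ≤-antisym (≤-pred (In-width g X Y pXY)) (rightmost w _ (proj₂ (cols w ≤-refl)))
  top : In P w Y
  top = subst (λ x → In P x Y) X≡w pXY
  ≤-height : ∀ {x y} → In P x y → y ≤ Y
  ≤-height p = topmost _ _ p
  h≤1+Y : h ≤ suc Y
  h≤1+Y = ≤-trans (m≤n+m∸n h 1) (s≤s (bound h rows))
    where
    bound : ∀ h′ → (∀ y → y < h′ → ∃ λ x → In P x y) → h′ ∸ 1 ≤ Y
    bound zero     _ = z≤n
    bound (suc h′) r = ≤-height (proj₂ (r h′ ≤-refl))
  module Rising = Between P rowConvex _≤_ ≤-refl ≤-antisym ≤-total m≤n⇒m<n∨m≡n (λ i → inj₁ (<⇒≤ i))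
  -- For the converse order it is the downward step that may leave the half-plane, so the two step
  -- conditions exchange roles.
  module Falling = Between P rowConvex _≥_ ≤-refl (flip ≤-antisym) (flip ≤-total)
    (λ i → inj₁ (m≤n⇒m≤1+n i))
    (λ i → map ≤-pred sym (m≤n⇒m<n∨m≡n i))
  sink : ∀ x → x < w → (∃ λ x′ → x < x′ × In P x′ 0) ⊎ (∀ y → In P (suc x) y → ∃ λ y′ → y′ ≤ y × In P x y′)
  sink x x<w with rows 0 (≤-<-trans z≤n (In-height g X Y pXY))
  ... | x₀ , p₀ with x₀ ≤? x
  ...   | no  x₀≰x = inj₁ (x₀ , ≰⇒> x₀≰x , p₀)
  ...   | yes x₀≤x = inj₂ λ y p →
    let (y′ , _ , i , q) = Rising.walk p₀ p x₀≤x (n≤1+n x) z≤n (connected _ _ _ _ p₀ p) (inj₁ ≤-refl)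
    in y′ , i , q

-- An open grid misses row 0, contrary to minimality of the box.
Valid⇒Closed : ∀ {h w} (g : Vec (Vec Bool h) (suc w)) → Valid (suc w , h , g) → ∃₂ λ b t → Closed g b t
Valid⇒Closed g V with Profile⇒Closed⊎Open g (Valid⇒Profile g V)
... | inj₁ c = c
... | inj₂ (β , t , o) with V
...   | (_ , rows) , _
  with x , p ← rows 0 (≤-<-trans z≤n (Grown.t<h (Open⇒Grown o)))
  with () ← Grown.floor (Open⇒Grown o) x 0 p

-- Enumeration

⋃[<_] : ∀ {A : Set} → ℕ → (ℕ → List A) → List A
⋃[< zero ]  f = []
⋃[< suc n ] f = ⋃[< n ] f ++ f n

module _ {A : Set} where

  ⋃⁺ : ∀ {n i} {x : A} {f : ℕ → List A} → i < n → x ∈ f i → x ∈ ⋃[< n ] f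
  ⋃⁺ {suc n} {f = f} i<1+n x∈ with m≤n⇒m<n∨m≡n i<1+n
  ... | inj₁ (s≤s i<n) = ∈-++⁺ˡ (⋃⁺ i<n x∈)
  ... | inj₂ refl      = ∈-++⁺ʳ (⋃[< n ] f) x∈

  ⋃⁻ : ∀ n {x : A} (f : ℕ → List A) → x ∈ ⋃[< n ] f → ∃ λ i → i < n × x ∈ f i
  ⋃⁻ (suc n) f x∈ with ∈-++⁻ (⋃[< n ] f) x∈
  ... | inj₁ y = let (i , i<n , z) = ⋃⁻ n f y in i , m<n⇒m<1+n i<n , z
  ... | inj₂ y = n , ≤-refl , y

  length-⋃ : ∀ n (f : ℕ → List A) → + length (⋃[< n ] f) ≡ Σ[< n ] (λ i → + length (f i))
  length-⋃ zero    f = refl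
  length-⋃ (suc n) f = trans (trans (cong +_ (length-++ (⋃[< n ] f))) (ℤ.pos-+ (length (⋃[< n ] f)) _))
                             (cong (_⊕ + length (f n)) (length-⋃ n f))

  ⋃-unique : ∀ n (f : ℕ → List A) → (∀ i → i < n → Unique (f i)) →
    (∀ i j x → i < n → j < n → x ∈ f i → x ∈ f j → i ≡ j) → Unique (⋃[< n ] f)
  ⋃-unique zero    f u sep = []
  ⋃-unique (suc n) f u sep = ++⁺
    (⋃-unique n f (λ i i<n → u i (m<n⇒m<1+n i<n)) (λ i j x p q → sep i j x (m<n⇒m<1+n p) (m<n⇒m<1+n q)))
    (u n ≤-refl)
    λ (x∈ , x∈fn) → let (i , i<n , x∈fi) = ⋃⁻ n f x∈
                    in <⇒≢ i<n (sep i n _ (m<n⇒m<1+n i<n) ≤-refl x∈fi x∈fn)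

-- All ways of adding k columns on the left of a grid with leftmost column
-- [b , t], respectively [suc β , t], so as to end up with a Closed one.
closedCompletions : ∀ (k : ℕ) {h w} → Vec (Vec Bool h) w → (b t : ℕ) → List Shape
closedCompletions zero    g b t = (_ , _ , g) ∷ []
closedCompletions (suc k) {h} g b t = ⋃[< suc (t ∸ b) ] λ d → ⋃[< suc d ] λ i →
  closedCompletions k (column h (b + (d ∸ i)) (b + d) ∷ g) (b + (d ∸ i)) (b + d)

openCompletions : ∀ (k : ℕ) {h w} → Vec (Vec Bool h) w → (β t : ℕ) → List Shape
openCompletions zero    g β t = []
openCompletions (suc k) {h} g β t = ⋃[< suc (t ∸ suc β) ] λ d →
  closedCompletions k (column h 0 (suc β + d) ∷ g) 0 (suc β + d) ++
  ⋃[< suc β ] λ β′ → openCompletions k (column h (suc β′) (suc β + d) ∷ g) β′ (suc β + d)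

-- Box of width suc k and height suc t.
boxShapes : ℕ → ℕ → List Shape
boxShapes k t =
  closedCompletions k (column (suc t) 0 t ∷ []) 0 t ++
  ⋃[< t ] λ β → openCompletions k (column (suc t) (suc β) t ∷ []) β t

-- Lengths of the lists

length-++-⋃ : ∀ {A : Set} (xs : List A) n (f : ℕ → List A) →
  + length (xs ++ ⋃[< n ] f) ≡ + length xs ⊕ Σ[< n ] (λ i → + length (f i))
length-++-⋃ xs n f = trans (trans (cong +_ (length-++ xs)) (ℤ.pos-+ (length xs) _))
                           (cong (+ length xs ⊕_) (length-⋃ n f))

-- The count depends only on the difference of top and bottom, which the form `b + d` makes
-- explicit.
length-closed : ∀ k {h w} (g : Vec (Vec Bool h) w) b d →
  + length (closedCompletions k g b (b + d)) ≡ binom (k + k + d) (k + k)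
length-closed zero    g b d = sym (binom-zero d)
length-closed (suc k) {h} g b d = begin
  + length (closedCompletions (suc k) g b (b + d))
    ≡⟨ length-⋃ (suc (b + d ∸ b)) _ ⟩
  Σ[< suc (b + d ∸ b) ] (λ d′ → + length (⋃[< suc d′ ] (next d′)))
    ≡⟨ cong (λ z → Σ[< suc z ] (λ d′ → + length (⋃[< suc d′ ] (next d′)))) (m+n∸m≡n b d) ⟩
  Σ[< suc d ] (λ d′ → + length (⋃[< suc d′ ] (next d′)))
    ≡⟨ Σ-cong (suc d) (λ d′ _ → trans (length-⋃ (suc d′) (next d′)) (Σ-cong (suc d′) (λ i i≤d′ → count d′ i i≤d′))) ⟩
  Σ[< suc d ] (λ d′ → Σ[< suc d′ ] (λ i → binom (k + k + i) (k + k)))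
    ≡⟨ closed-step k d ⟩
  binom (suc k + suc k + d) (suc k + suc k) ∎
  where
  open ≡-Reasoning
  next : ℕ → ℕ → List Shape
  next d′ i = closedCompletions k (column h (b + (d′ ∸ i)) (b + d′) ∷ g) (b + (d′ ∸ i)) (b + d′)
  count : ∀ d′ i → i < suc d′ → + length (next d′ i) ≡ binom (k + k + i) (k + k)
  count d′ i (s≤s i≤d′) = trans
    -- The top is rewritten as the new bottom plus `i`, the form of the induction hypothesis.
    (cong (λ z → + length (closedCompletions k (column h (b + (d′ ∸ i)) (b + d′) ∷ g) (b + (d′ ∸ i)) z))
          (trans (cong (λ z → b + z) (sym (m∸n+n≡m i≤d′))) (sym (+-assoc b (d′ ∸ i) i))))
    (length-closed k _ (b + (d′ ∸ i)) i)

length-open : ∀ k {h w} (g : Vec (Vec Bool h) w) β t → β < t →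
  + length (openCompletions k g β t) ≡ openCount k β t
length-open zero    g β t _ = refl
length-open (suc k) {h} g β t β<t = begin
  + length (openCompletions (suc k) g β t)
    ≡⟨ length-⋃ (suc (t ∸ suc β)) _ ⟩
  Σ[< suc (t ∸ suc β) ] _
    ≡⟨ Σ-cong (suc (t ∸ suc β)) (λ d _ → trans
         (length-++-⋃ (closedCompletions k (column h 0 (suc β + d) ∷ g) 0 (suc β + d)) (suc β) _)
         (cong₂ _⊕_ (length-closed k (column h 0 (suc β + d) ∷ g) 0 (suc β + d))
            (Σ-cong (suc β) λ β′ β′<1+β →
               length-open k (column h (suc β′) (suc β + d) ∷ g) β′ (suc β + d) (≤-trans β′<1+β (m≤m+n (suc β) d))))) ⟩
  Σ[< suc (t ∸ suc β) ] (λ d → binom (k + k + (suc β + d)) (k + k)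
                               ⊕ Σ[< suc β ] (λ β′ → openCount k β′ (suc β + d)))
    ≡⟨ open-step k β (t ∸ suc β) ⟩
  openCount (suc k) β (suc β + (t ∸ suc β))
    ≡⟨ cong (openCount (suc k) β) (m+[n∸m]≡n β<t) ⟩
  openCount (suc k) β t ∎
  where open ≡-Reasoning

length-boxShapes : ∀ k t → + length (boxShapes k t) ≡ binom (k + t) k ⊛ binom (k + t) k
length-boxShapes k t = trans
  (length-++-⋃ (closedCompletions k (column (suc t) 0 t ∷ []) 0 t) t _)
  (trans (cong₂ _⊕_ (length-closed k (column (suc t) 0 t ∷ []) 0 t)
                    (Σ-cong t λ β → length-open k (column (suc t) (suc β) t ∷ []) β t))
         (box-count k t))

-- Absence of repetitions

cell : Shape → ℕ → ℕ → Bool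
cell (_ , _ , g) = atGrid g

-- Grids are compared cell by cell, so that none has to be transported along an equation between
-- widths.
record Completes (k : ℕ) {h w} (g : Vec (Vec Bool h) w) (P : Shape) : Set where
  field
    width≡  : width P ≡ k + w
    height≡ : height P ≡ h
    suffix  : ∀ x y → cell P (k + x) y ≡ atGrid g x y

Completes-tail : ∀ {k h w} {c : Vec Bool h} {g : Vec (Vec Bool h) w} {P} →
  Completes k (c ∷ g) P → Completes (suc k) g P
Completes-tail {k} {w = w} {P = P} e = record
  { width≡  = trans width≡ (+-suc k w)
  ; height≡ = height≡
  ; suffix  = λ x y → trans (cong (λ z → cell P z y) (sym (+-suc k x))) (suffix (suc x) y)
  }
  where open Completes e

-- Column `k` of `P` records which column was added, so different choices have no common completion.
-- All disjointness within one box rests on this.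
Completes-column : ∀ {k h w b t b′ t′} {g : Vec (Vec Bool h) w} {P} →
  b ≤ t → t < h → b′ ≤ t′ → t′ < h →
  Completes k (column h b t ∷ g) P → Completes k (column h b′ t′ ∷ g) P → b ≡ b′ × t ≡ t′
Completes-column b≤t t<h b′≤t′ t′<h e e′ = column-injective b≤t t<h b′≤t′ t′<h
  (λ y → trans (sym (Completes.suffix e 0 y)) (Completes.suffix e′ 0 y))

closedCompletions⁻ : ∀ k {h w} (g : Vec (Vec Bool h) w) b t {P} →
  P ∈ closedCompletions k g b t → Completes k g P
closedCompletions⁻ zero g b t (here refl) = record { width≡ = refl ; height≡ = refl ; suffix = λ _ _ → refl }
closedCompletions⁻ (suc k) g b t P∈ =
  let (d , _ , P∈′) = ⋃⁻ (suc (t ∸ b)) _ P∈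
      (i , _ , P∈″) = ⋃⁻ (suc d) _ P∈′
  in Completes-tail (closedCompletions⁻ k _ (b + (d ∸ i)) (b + d) P∈″)

openCompletions⁻ : ∀ k {h w} (g : Vec (Vec Bool h) w) β t {P} →
  P ∈ openCompletions k g β t → Completes k g P
openCompletions⁻ (suc k) {h} g β t P∈ with ⋃⁻ (suc (t ∸ suc β)) _ P∈
... | d , _ , P∈′ with ∈-++⁻ (closedCompletions k (column h 0 (suc β + d) ∷ g) 0 (suc β + d)) P∈′
...   | inj₁ P∈″ = Completes-tail (closedCompletions⁻ k _ 0 (suc β + d) P∈″)
...   | inj₂ P∈″ = let (β′ , _ , P∈‴) = ⋃⁻ (suc β) _ P∈″
                   in Completes-tail (openCompletions⁻ k _ β′ (suc β + d) P∈‴)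

index≤ : ∀ {b t d} → b ≤ t → d < suc (t ∸ b) → b + d ≤ t
index≤ {b} b≤t (s≤s d≤) = ≤-trans (+-monoʳ-≤ b d≤) (≤-reflexive (m+[n∸m]≡n b≤t))

closedCompletions-unique : ∀ k {h w} (g : Vec (Vec Bool h) w) b t → b ≤ t → t < h →
  Unique (closedCompletions k g b t)
closedCompletions-unique zero g b t _ _ = [] ∷ []
closedCompletions-unique (suc k) {h} g b t b≤t t<h =
  ⋃-unique (suc (t ∸ b)) _
    (λ d d< → ⋃-unique (suc d) _
      (λ i i< → closedCompletions-unique k _ (b + (d ∸ i)) (b + d) (+-monoʳ-≤ b (m∸n≤m d i)) (top< d d<))
      (λ i j P i< j< P∈ P∈′ → ∸-cancelˡ-≡ (≤-pred i<) (≤-pred j<)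
        (+-cancelˡ-≡ b _ _ (proj₁ (Completes-column (bot≤ d i) (top< d d<) (bot≤ d j) (top< d d<)
          (completes d i P∈) (completes d j P∈′))))))
    (λ d d′ P d< d′< P∈ P∈′ →
      let (i , _ , q)  = ⋃⁻ (suc d) _ P∈
          (j , _ , q′) = ⋃⁻ (suc d′) _ P∈′
      in +-cancelˡ-≡ b _ _ (proj₂ (Completes-column (bot≤ d i) (top< d d<) (bot≤ d′ j) (top< d′ d′<)
           (completes d i q) (completes d′ j q′))))
  where
  top< : ∀ d → d < suc (t ∸ b) → b + d < h
  top< d d< = ≤-<-trans (index≤ b≤t d<) t<h
  bot≤ : ∀ d i → b + (d ∸ i) ≤ b + d
  bot≤ d i = +-monoʳ-≤ b (m∸n≤m d i)
  completes : ∀ d i {P} →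
    P ∈ closedCompletions k (column h (b + (d ∸ i)) (b + d) ∷ g) (b + (d ∸ i)) (b + d) →
    Completes k (column h (b + (d ∸ i)) (b + d) ∷ g) P
  completes d i = closedCompletions⁻ k _ (b + (d ∸ i)) (b + d)

module LastColumn (k : ℕ) {h w : ℕ} (g : Vec (Vec Bool h) w) where

  -- The common form of `boxShapes`, where `g` is empty and n = t, and of each branch of
  -- `openCompletions`, where n = β + 1.
  candidates : ℕ → ℕ → List Shape
  candidates n t = closedCompletions k (column h 0 t ∷ g) 0 t ++
                   ⋃[< n ] λ β → openCompletions k (column h (suc β) t ∷ g) β t

  candidates⁻ : ∀ n t {P} → n ≤ t → P ∈ candidates n t → ∃ λ b → b ≤ t × Completes k (column h b t ∷ g) P
  candidates⁻ n t n≤t P∈ with ∈-++⁻ (closedCompletions k (column h 0 t ∷ g) 0 t) P∈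
  ... | inj₁ q = 0 , z≤n , closedCompletions⁻ k _ 0 t q
  ... | inj₂ q = let (β , β<n , q′) = ⋃⁻ n _ q in suc β , ≤-trans β<n n≤t , openCompletions⁻ k _ β t q′

  candidates-unique : ∀ n t → n ≤ t → t < h →
    (∀ β → β < n → Unique (openCompletions k (column h (suc β) t ∷ g) β t)) → Unique (candidates n t)
  candidates-unique n t n≤t t<h u = ++⁺
    (closedCompletions-unique k _ 0 t z≤n t<h)
    (⋃-unique n _ u λ β β′ P β< β′< P∈ P∈′ → suc-injective (proj₁ (Completes-column
      (≤-trans β< n≤t) t<h (≤-trans β′< n≤t) t<h
      (openCompletions⁻ k _ β t P∈) (openCompletions⁻ k _ β′ t P∈′))))
    λ (P∈ , P∈′) → let (β , β< , q) = ⋃⁻ n _ P∈′ in 0≢1+n (proj₁ (Completes-column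
      z≤n t<h (≤-trans β< n≤t) t<h (closedCompletions⁻ k _ 0 t P∈) (openCompletions⁻ k _ β t q)))

open LastColumn

openCompletions-unique : ∀ k {h w} (g : Vec (Vec Bool h) w) β t → β < t → t < h →
  Unique (openCompletions k g β t)
openCompletions-unique zero    g β t _ _ = []
openCompletions-unique (suc k) g β t β<t t<h =
  ⋃-unique (suc (t ∸ suc β)) _
    (λ d d< → candidates-unique k g (suc β) (suc β + d) (m≤m+n (suc β) d) (top< d d<)
      λ β′ β′< → openCompletions-unique k _ β′ (suc β + d) (≤-trans β′< (m≤m+n (suc β) d)) (top< d d<))
    (λ d d′ P d< d′< P∈ P∈′ →
      let (_ , i , e)  = candidates⁻ k g (suc β) (suc β + d) (m≤m+n (suc β) d) P∈
          (_ , j , e′) = candidates⁻ k g (suc β) (suc β + d′) (m≤m+n (suc β) d′) P∈′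
      in +-cancelˡ-≡ (suc β) _ _ (proj₂ (Completes-column i (top< d d<) j (top< d′ d′<) e e′)))
  where
  top< : ∀ d → d < suc (t ∸ suc β) → suc β + d < _
  top< d d< = ≤-<-trans (index≤ β<t d<) t<h

boxShapes-unique : ∀ k t → Unique (boxShapes k t)
boxShapes-unique k t = candidates-unique k [] t t ≤-refl ≤-refl
  λ β β<t → openCompletions-unique k _ β t β<t ≤-refl

boxShapes⁻ : ∀ k t {P} → P ∈ boxShapes k t → width P ≡ suc k × height P ≡ suc t
boxShapes⁻ k t P∈ = let (_ , _ , e) = candidates⁻ k [] t t ≤-refl P∈
                    in trans (Completes.width≡ e) (+-comm k 1) , Completes.height≡ e

-- Soundness and completeness of the lists

ClosedShape : Shape → Set
ClosedShape P = ∃₂ λ w h → ∃ λ g → ∃₂ λ b t → P ≡ (suc w , h , g) × Closed g b t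

closedCompletions-sound : ∀ k {h w} (g : Vec (Vec Bool h) (suc w)) b t {P} → Closed g b t →
  P ∈ closedCompletions k g b t → ClosedShape P
closedCompletions-sound zero g b t c (here refl) = _ , _ , g , b , t , refl , c
closedCompletions-sound (suc k) g b t c P∈ =
  let (d , d< , P∈′) = ⋃⁻ (suc (t ∸ b)) _ P∈
      (i , _ , P∈″) = ⋃⁻ (suc d) _ P∈′
  in closedCompletions-sound k _ (b + (d ∸ i)) (b + d)
       (grow c (m≤m+n b (d ∸ i)) (+-monoʳ-≤ b (m∸n≤m d i)) (index≤ (Grown.b≤t (Closed⇒Grown c)) d<)) P∈″

openCompletions-sound : ∀ k {h w} (g : Vec (Vec Bool h) (suc w)) β t {P} → Open g β t →
  P ∈ openCompletions k g β t → ClosedShape P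
openCompletions-sound (suc k) {h} g β t o P∈ with ⋃⁻ (suc (t ∸ suc β)) _ P∈
... | d , d< , P∈′ with ∈-++⁻ (closedCompletions k (column h 0 (suc β + d) ∷ g) 0 (suc β + d)) P∈′
...   | inj₁ P∈″ = closedCompletions-sound k _ 0 (suc β + d)
                     (close o (m≤m+n (suc β) d) (index≤ (Grown.b≤t (Open⇒Grown o)) d<)) P∈″
...   | inj₂ P∈″ = let (β′ , β′< , P∈‴) = ⋃⁻ (suc β) _ P∈″ in openCompletions-sound k _ β′ (suc β + d)
                     (grow o (≤-pred β′<) (m≤m+n (suc β) d) (index≤ (Grown.b≤t (Open⇒Grown o)) d<)) P∈‴

boxShapes-sound : ∀ k t {P} → P ∈ boxShapes k t → ClosedShape P
boxShapes-sound k t P∈ with ∈-++⁻ (closedCompletions k (column (suc t) 0 t ∷ []) 0 t) P∈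
... | inj₁ q = closedCompletions-sound k _ 0 t (root refl) q
... | inj₂ q = let (β , β<t , q′) = ⋃⁻ t _ q in openCompletions-sound k _ β t (root β<t refl) q′

closed-next : ∀ k {h w} (g : Vec (Vec Bool h) w) {b t b′ t′ P} → b ≤ b′ → b′ ≤ t′ → t′ ≤ t →
  P ∈ closedCompletions k (column h b′ t′ ∷ g) b′ t′ → P ∈ closedCompletions (suc k) g b t
closed-next k {h} g {b} {t} {b′} {t′} {P} b≤b′ b′≤t′ t′≤t P∈ =
  -- The indices are d = t′ - b and i = t′ - b′; `bottom` recovers b′ from them.
  ⋃⁺ (s≤s (∸-monoˡ-≤ b t′≤t)) (⋃⁺ (s≤s (∸-monoʳ-≤ t′ b≤b′))
    (subst₂ (λ x y → P ∈ closedCompletions k (column h x y ∷ g) x y) (sym bottom) (sym (m+[n∸m]≡n b≤t′)) P∈))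
  where
  b≤t′ : b ≤ t′
  b≤t′ = ≤-trans b≤b′ b′≤t′
  bottom : b + (t′ ∸ b ∸ (t′ ∸ b′)) ≡ b′
  bottom = begin
    b + (t′ ∸ b ∸ (t′ ∸ b′))   ≡⟨ +-∸-assoc b (∸-monoʳ-≤ t′ b≤b′) ⟨
    b + (t′ ∸ b) ∸ (t′ ∸ b′)   ≡⟨ cong (_∸ (t′ ∸ b′)) (m+[n∸m]≡n b≤t′) ⟩
    t′ ∸ (t′ ∸ b′)             ≡⟨ m∸[m∸n]≡n b′≤t′ ⟩
    b′                         ∎
    where open ≡-Reasoning

open-close : ∀ k {h w} (g : Vec (Vec Bool h) w) {β t t′ P} → β < t′ → t′ ≤ t →
  P ∈ closedCompletions k (column h 0 t′ ∷ g) 0 t′ → P ∈ openCompletions (suc k) g β t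
open-close k {h} g {β} {P = P} β<t′ t′≤t P∈ =
  ⋃⁺ (s≤s (∸-monoˡ-≤ (suc β) t′≤t))
    (∈-++⁺ˡ (subst (λ y → P ∈ closedCompletions k (column h 0 y ∷ g) 0 y) (sym (m+[n∸m]≡n β<t′)) P∈))

open-next : ∀ k {h w} (g : Vec (Vec Bool h) w) {β t β′ t′ P} → β′ ≤ β → β < t′ → t′ ≤ t →
  P ∈ openCompletions k (column h (suc β′) t′ ∷ g) β′ t′ → P ∈ openCompletions (suc k) g β t
open-next k {h} g {β} {t} {β′} {t′} {P} β′≤β β<t′ t′≤t P∈ =
  ⋃⁺ (s≤s (∸-monoˡ-≤ (suc β) t′≤t))
    (∈-++⁺ʳ (closedCompletions k (column h 0 (suc β + (t′ ∸ suc β)) ∷ g) 0 (suc β + (t′ ∸ suc β)))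
      (⋃⁺ (s≤s β′≤β)
        (subst (λ y → P ∈ openCompletions k (column h (suc β′) y ∷ g) β′ y) (sym (m+[n∸m]≡n β<t′)) P∈)))

module _ {h : ℕ} {P : Shape} where

  -- Each induction step removes the leftmost column of the grid and counts it among the columns
  -- still to be added, keeping `w + k` fixed, until only the root column is left, where `boxShapes`
  -- starts.
  open-complete : ∀ {w β t} {g : Vec (Vec Bool (suc h)) (suc w)} → Open g β t → ∀ k →
    P ∈ openCompletions k g β t → P ∈ boxShapes (w + k) h
  open-complete (root {β} β<t refl) k P∈ =
    ∈-++⁺ʳ (closedCompletions k (column (suc h) 0 h ∷ []) 0 h) (⋃⁺ β<t P∈)
  open-complete {suc w} (grow {g = g} o β′≤β β<t′ t′≤t) k P∈ =
    subst (λ z → P ∈ boxShapes z h) (+-suc w k)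
      (open-complete o (suc k) (open-next k g β′≤β β<t′ t′≤t P∈))

  closed-complete : ∀ {w b t} {g : Vec (Vec Bool (suc h)) (suc w)} → Closed g b t → ∀ k →
    P ∈ closedCompletions k g b t → P ∈ boxShapes (w + k) h
  closed-complete (root refl) k P∈ = ∈-++⁺ˡ P∈
  closed-complete {suc w} (close {g = g} o β<t′ t′≤t) k P∈ =
    subst (λ z → P ∈ boxShapes z h) (+-suc w k)
      (open-complete o (suc k) (open-close k g β<t′ t′≤t P∈))
  closed-complete {suc w} (grow {g = g} c b≤b′ b′≤t′ t′≤t) k P∈ =
    subst (λ z → P ∈ boxShapes z h) (+-suc w k)
      (closed-complete c (suc k) (closed-next k g b≤b′ b′≤t′ t′≤t P∈))

boxShapes⁺ : ∀ {h w} (g : Vec (Vec Bool (suc h)) (suc w)) → Valid (suc w , suc h , g) →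
  (suc w , suc h , g) ∈ boxShapes w h
boxShapes⁺ {h} {w} g V = let (_ , _ , c) = Valid⇒Closed g V in
  -- With no columns left to add, the grid is its own completion.
  subst (λ z → (suc w , suc h , g) ∈ boxShapes z h) (+-identityʳ w) (closed-complete c 0 (here refl))

-- Widths k + 1 and heights m - k + 1 exhaust the nonempty boxes of semi-perimeter m + 2.
shapes : ℕ → List Shape
shapes m = ⋃[< suc m ] λ k → boxShapes k (m ∸ k)

length-shapes : ∀ m → length (shapes m) ≡ (m + m) C m
length-shapes m = ℤ.+-injective (begin
  + length (shapes m)
    ≡⟨ length-⋃ (suc m) (λ k → boxShapes k (m ∸ k)) ⟩
  Σ[< suc m ] (λ k → + length (boxShapes k (m ∸ k)))
    ≡⟨ Σ-cong (suc m) (λ k _ → length-boxShapes k (m ∸ k)) ⟩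
  Σ[< suc m ] (λ k → binom (k + (m ∸ k)) k ⊛ binom (k + (m ∸ k)) k)
    ≡⟨ Σ-binom² m ⟩
  binom (m + m) m ∎)
  where open ≡-Reasoning

shapes-unique : ∀ m → Unique (shapes m)
shapes-unique m = ⋃-unique (suc m) _ (λ k _ → boxShapes-unique k (m ∸ k))
  λ k k′ P _ _ P∈ P∈′ → suc-injective
    (trans (sym (proj₁ (boxShapes⁻ k (m ∸ k) P∈))) (proj₁ (boxShapes⁻ k′ (m ∸ k′) P∈′)))

shapes⁻ : ∀ m {P} → P ∈ shapes m → RectAscOfSemiPerimeter (2 + m) P
shapes⁻ m P∈ with ⋃⁻ (suc m) _ P∈
... | k , s≤s k≤m , P∈′ with boxShapes⁻ k (m ∸ k) P∈′ | boxShapes-sound k (m ∸ k) P∈′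
...   | w≡ , h≡ | _ , _ , _ , _ , _ , refl , c =
  let (box , ascending , rectangular) = Closed⇒Valid c in
  box , ascending , rectangular ,
  trans (cong₂ _+_ w≡ h≡) (cong suc (trans (+-suc k (m ∸ k)) (cong suc (m+[n∸m]≡n k≤m))))

shapes⁺ : ∀ m P → RectAscOfSemiPerimeter (2 + m) P → P ∈ shapes m
shapes⁺ m (zero , h , []) (_ , (((_ , _ , ()) , _) , _) , _)
shapes⁺ m (suc w , zero , g) (_ , (((x , y , p) , _) , _) , _) with () ← In-height g x y p
shapes⁺ m (suc w , suc h , g) (box , ascending , rectangular , e) =
  ⋃⁺ (s≤s w≤m) (subst (λ z → (suc w , suc h , g) ∈ boxShapes w z) h≡
    (boxShapes⁺ g (box , ascending , rectangular)))
  where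
  w+h≡m : w + h ≡ m
  w+h≡m = suc-injective (suc-injective (trans (cong suc (sym (+-suc w h))) e))
  w≤m : w ≤ m
  w≤m = ≤-trans (m≤m+n w h) (≤-reflexive w+h≡m)
  h≡ : h ≡ m ∸ w
  h≡ = trans (sym (m+n∸m≡n w h)) (cong (_∸ w) w+h≡m)

theorem4 : (n : ℕ) → 2 ≤ n →
    HasCount (RectAscOfSemiPerimeter n) ((2 * n ∸ 4) C (n ∸ 2))
theorem4 (suc (suc m)) (s≤s (s≤s z≤n)) =
  shapes m , shapes-unique m , (λ P → mk⇔ (shapes⁻ m) (shapes⁺ m P)) ,
  trans (length-shapes m) (cong (_C m) (sym 2[m+2]∸4≡m+m))
  where
  2[m+2]∸4≡m+m : 2 * suc (suc m) ∸ 4 ≡ m + m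
  2[m+2]∸4≡m+m = trans (cong (_∸ 4) (*-distribˡ-+ 2 2 m)) (cong (λ z → m + z) (+-identityʳ m))
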